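{- Let $k\ge 1$ be fixed. For the MMB structure, let $\sigma(k,n)$ denote the number of hashes in the membership proof of the $k$-th newest item $x_{n-k+1}$ when $|X|=n\ge k$. Then its expected (amortized) value over $n$ satisfies $$\bar\sigma(k):=\lim_{N\to\infty}\frac1N\sum_{n=k}^{k+N-1}\sigma(k,n)\ \le\ \frac{11}{8}\log_2\!\left(\frac{k+1}{3}\right)+\frac92-\frac{9}{4(k+1)}.$$
   Context: $X=(x_1,x_2,\dots)$ is an append-only list; $X_n$ is its state with $n$ items; leaf $h_i$ corresponds to $x_i$. A mountain of height $s\ge0$ is a perfect binary tree with $2^s$ leaves; its root is its peak. The U-MMB for $X_n$ is an ordered (left-to-right) list of mountains whose leaves read left to right are $h_1,\dots,h_n$, built inductively from the empty list: to append, (1) add the new leaf as a height-0 mountain at the right end; (2) if some two consecutive mountains have equal height, take the rightmost such pair, of height $s$, and replace it in place by a mountain of height $s+1$ whose new peak has the two old peaks as children. The MMB partitions the mountain list into ranges: consecutive mountains $M,M'$ ($M$ left of $M'$) are in different ranges iff their heights differ by 2, or the mountain immediately left of $M$ exists and has the same height as $M$. For a range with peaks $P_1,\dots,P_r$ (left to right), range nodes are $R_1$ (single child $P_1$) and $R_j$ with children $R_{j-1},P_j$; $R_r$ is the range root. For range roots $Q_1,\dots,Q_q$ (left to right), belt nodes are $B_1$ (single child $Q_1$) and $B_j$ with children $B_{j-1},Q_j$; $B_q$ is the root. The membership proof of a leaf is the list of hashes of the siblings of the nodes on the path from the leaf to the root, where a node without sibling (child of a single-child node) contributes no hash. The paper's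 "expected proof size for fixed $k$ and variable $n$" is the limiting average $\bar\sigma(k)$ in the claim. -}

module Defs where

open import Data.Nat using (ℕ; zero; suc; _+_; _*_; _∸_; _^_; _<ᵇ_; _≡ᵇ_; ∣_-_∣)
import Data.Nat as ℕ
open import Data.Bool using (Bool; true; false; if_then_else_; _∨_)
open import Data.List using (List; []; _∷_; reverse; map; upTo)
open import Data.Nat.ListAction using (sum)
open import Data.Maybe using (Maybe; just; nothing)
open import Data.Integer using (ℤ; +_; -[1+_])
import Data.Integer as ℤ
open import Data.Rational using (ℚ; ↥_; ↧ₙ_)

-- U-MMB mountain heights.
-- We keep the list of mountain heights REVERSED (rightmost mountain first).

-- Step (2): merge the rightmost pair of consecutive equal-height mountains
-- (in the reversed list this is the first such adjacent pair found).
mergeRightmost : List ℕ → List ℕ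
mergeRightmost (a ∷ b ∷ rest) =
  if a ≡ᵇ b then suc a ∷ rest else a ∷ mergeRightmost (b ∷ rest)
mergeRightmost xs = xs

appendItem : List ℕ → List ℕ
appendItem r = mergeRightmost (0 ∷ r)

heightsRev : ℕ → List ℕ
heightsRev zero    = []
heightsRev (suc n) = appendItem (heightsRev n)

heights : ℕ → List ℕ
heights n = reverse (heightsRev n)

isBreak : Maybe ℕ → ℕ → ℕ → Bool
isBreak p c d = (∣ c - d ∣ ≡ᵇ 2) ∨ prevEq p
  where
  prevEq : Maybe ℕ → Bool
  prevEq nothing  = false
  prevEq (just e) = e ≡ᵇ c

consHead : ℕ → List (List ℕ) → List (List ℕ)
consHead c []       = (c ∷ []) ∷ []
consHead c (g ∷ gs) = (c ∷ g) ∷ gs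

groups : Maybe ℕ → ℕ → List ℕ → List (List ℕ)
groups p c []       = (c ∷ []) ∷ []
groups p c (d ∷ rs) =
  if isBreak p c d then (c ∷ []) ∷ groups (just c) d rs
                   else consHead c (groups (just c) d rs)

ranges : List ℕ → List (List ℕ)
ranges []       = []
ranges (c ∷ rs) = groups nothing c rs

data Tree : Set where
  leaf : Tree
  one  : Tree → Tree
  two  : Tree → Tree → Tree

leaves : Tree → ℕ
leaves leaf      = 1
leaves (one t)   = leaves t
leaves (two l r) = leaves l + leaves r

mountain : ℕ → Tree
mountain zero    = leaf
mountain (suc s) = two (mountain s) (mountain s)

-- chain [T₁,…,T_r]: C₁ = one T₁, C_j = two C_{j-1} T_j; result C_r.
-- (Used for range nodes and belt nodes; the empty list never occurs for n ≥ 1.)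
chainFrom : Tree → List Tree → Tree
chainFrom acc []       = acc
chainFrom acc (t ∷ ts) = chainFrom (two acc t) ts

chain : List Tree → Tree
chain []       = leaf
chain (t ∷ ts) = chainFrom (one t) ts

rangeRoot : List ℕ → Tree
rangeRoot hs = chain (map mountain hs)

mmb : ℕ → Tree
mmb n = chain (map rangeRoot (ranges (heights n)))

-- Number of hashes in the membership proof of the leaf with 0-based index i
-- (leaves read left to right): one hash per step where the node has a sibling.
proofSize : Tree → ℕ → ℕ
proofSize leaf      i = 0
proofSize (one t)   i = proofSize t i
proofSize (two l r) i =
  if i <ᵇ leaves l then suc (proofSize l i) else suc (proofSize r (i ∸ leaves l))

-- σ(k,n): proof size of x_{n-k+1} (0-based leaf index n - k) in the MMB for X_n.
σ : ℕ → ℕ → ℕ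
σ k n = proofSize (mmb n) (n ∸ k)

σsum : ℕ → ℕ → ℕ
σsum k M = sum (map (λ j → σ k (k + j)) (upTo (suc M)))

avg : ℕ → ℕ → ℚ
avg k M = Data.Rational._/_ (+ σsum k M) (suc M)

-- a ≤ log₂ r for rationals a, r with r > 0, expressed without reals:
-- writing a = p/q (q > 0) and r = u/v (u,v > 0), a ≤ log₂ r ⇔ 2^p ≤ r^q
-- ⇔ 2^{p⁺} · v^q ≤ 2^{p⁻} · u^q, where p = p⁺ - p⁻.

posPart : ℤ → ℕ
posPart (+ m)    = m
posPart -[1+ m ] = 0

negPart : ℤ → ℕ
negPart (+ m)    = 0
negPart -[1+ m ] = suc m

_≤log₂_ : ℚ → ℚ → Set
a ≤log₂ r =
  2 ^ posPart (↥ a) * (↧ₙ r) ^ (↧ₙ a) ℕ.≤ 2 ^ negPart (↥ a) * ℤ.∣ ↥ r ∣ ^ (↧ₙ a)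

{-# OPTIONS --safe #-}
module Submission where

-- Write n + 1 in binary with digits …, b₁, b₀ and leading 1 dropped.  Mountain i,
-- counted from the right, has height i + bᵢ, and a range break separates mountains
-- i + 1 and i iff bᵢ₊₁ = 1 and not bᵢ = bᵢ₊₂ = 1.  So the proof size of the k-th
-- newest item is a function of the low digits of n + 1 (one less when the item lies
-- in the first range, which forces all higher digits to agree and has density 0),
-- and the averages converge to the mean of that function over the low digits.
-- Removing the lowest mountain replaces k by ⌊(k - b₀)/2⌋ and lowers the expected
-- size by 1 + 3/8, plus the probability O(1/k) that no break has occurred so far.
-- Solving this recursion gives, for k + 1 = 2^p + m with 0 ≤ m < 2^p, a bound in
-- terms of p + m/2^p ≤ log₂ (k + 1); there is enough room to replace log₂ 3 by 8/5.

open import Defs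

-- For `k + 1 = 2 ^ p + m` the limit is an explicit rational,
-- `digitSum (3 + p) (size k) / 2 ^ (3 + p)`, so both conjuncts follow from comparing the averages
-- with it. For large `n`, `size` never underestimates, so the upper comparison is direct. The items
-- of the first range, where it is one too large, matter only from below: there the constancy of the
-- higher digits is tested on `L` of them, with `L` chosen after the tolerance. The interpolation
-- `p + m / 2 ^ p` suits the recursion because it is linear in `m` and thus reproduces itself
-- exactly when `k + 1` is halved with rounding up and down. The recursion yields the additive
-- constant 9/4, whereas 9/2 - 11/8 * 8/5 = 23/10, so the room is 1/20.

module Digits where

  open import Data.Bool using (Bool; true; false; if_then_else_; _∧_; not; T)
  open import Data.List using (List; []; _∷_; _++_; length; map; foldl; foldr; take; drop; applyUpTo)
  open import Data.List.Properties using (reverse-foldl; take++drop≡id; length-take)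
  open import Data.List.Relation.Unary.All using (All; []; _∷_)
  open import Data.List.Relation.Unary.All.Properties using (++⁻ʳ; take⁺)
  open import Data.Maybe using (Maybe; just; nothing)
  open import Data.Nat
  open import Data.Nat.ListAction using (sum)
  open import Data.Nat.Properties
  open import Data.Nat.Solver using (module +-*-Solver)
  open import Data.Product using (∃; ∃₂; _×_; _,_; proj₁; proj₂)
  open import Data.Sum using (_⊎_; inj₁; inj₂)
  open import Data.Unit using (tt)
  open import Function using (_∘_; id; flip)
  open import Relation.Binary.PropositionalEquality hiding (J)
  open import Relation.Nullary using (yes; no; contradiction)
  open +-*-Solver using (solve; _:+_; _:*_; _:=_; con)

  -- Binary digits and mountain heights.

  bit : Bool → ℕ
  bit false = 0
  bit true  = 1

  increment : List Bool → List Bool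
  increment []           = false ∷ []
  increment (false ∷ bs) = true ∷ bs
  increment (true  ∷ bs) = false ∷ increment bs

  -- Binary digits of n + 1, least significant first, without the leading 1.
  digits : ℕ → List Bool
  digits zero    = []
  digits (suc n) = increment (digits n)

  value : List Bool → ℕ
  value []       = 1
  value (b ∷ bs) = bit b + (value bs + value bs)

  value-increment : ∀ bs → value (increment bs) ≡ suc (value bs)
  value-increment []           = refl
  value-increment (false ∷ bs) = refl
  value-increment (true  ∷ bs) rewrite value-increment bs =
    cong suc (+-suc (value bs) (value bs))

  value-digits : ∀ n → value (digits n) ≡ suc n
  value-digits zero    = refl
  value-digits (suc n) = trans (value-increment (digits n)) (cong suc (value-digits n))

  value<2^ : ∀ bs → value bs < 2 ^ suc (length bs)
  value<2^ []       = s≤s (s≤s z≤n)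
  value<2^ (b ∷ bs) = begin-strict
    bit b + (v + v)      ≤⟨ +-monoˡ-≤ (v + v) (bit≤1 b) ⟩
    suc (v + v)          <⟨ s≤s (≤-reflexive (sym (+-suc v v))) ⟩
    suc v + suc v        ≤⟨ +-mono-≤ (value<2^ bs) (value<2^ bs) ⟩
    p + p                ≡⟨ cong (p +_) (sym (+-identityʳ p)) ⟩
    2 ^ suc (length (b ∷ bs)) ∎
    where
    open ≤-Reasoning
    v = value bs
    p = 2 ^ suc (length bs)
    bit≤1 : ∀ b → bit b ≤ 1
    bit≤1 false = z≤n
    bit≤1 true  = s≤s z≤n

  ≡ᵇ-refl : ∀ i → (i ≡ᵇ i) ≡ true
  ≡ᵇ-refl zero    = refl
  ≡ᵇ-refl (suc i) = ≡ᵇ-refl i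

  i≢ᵇ1+i : ∀ i → (i ≡ᵇ suc i) ≡ false
  i≢ᵇ1+i zero    = refl
  i≢ᵇ1+i (suc i) = i≢ᵇ1+i i

  heightsFrom : ℕ → List Bool → List ℕ
  heightsFrom i []       = []
  heightsFrom i (b ∷ bs) = (bit b + i) ∷ heightsFrom (suc i) bs

  -- Binary carry. On digit 0 the incoming mountain of height `i` meets one of equal height and
  -- merges, giving digit 1. On digit 1 it stays as digit 0, and the old mountain of height `i + 1`
  -- plays the incoming role one position up.
  mergeRightmost-heightsFrom : ∀ i bs →
    mergeRightmost (i ∷ heightsFrom i bs) ≡ heightsFrom i (increment bs)
  mergeRightmost-heightsFrom i []           = refl
  mergeRightmost-heightsFrom i (false ∷ bs) rewrite ≡ᵇ-refl i = refl
  mergeRightmost-heightsFrom i (true  ∷ bs) rewrite i≢ᵇ1+i i =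
    cong (i ∷_) (mergeRightmost-heightsFrom (suc i) bs)

  heightsRev-digits : ∀ n → heightsRev n ≡ heightsFrom 0 (digits n)
  heightsRev-digits zero    = refl
  heightsRev-digits (suc n) rewrite heightsRev-digits n =
    mergeRightmost-heightsFrom 0 (digits n)

  -- The tree as a left-to-right scan.

  -- Scanning the mountains from left to right, a state consists of the belt of
  -- the completed ranges, the chain of the current range, and the heights of the
  -- last two mountains.
  data State : Set where
    empty : State
    st    : Maybe Tree → Tree → Maybe ℕ → ℕ → State

  join : Maybe Tree → Tree → Tree
  join nothing  Q = one Q
  join (just B) Q = two B Q

  finish : State → Tree
  finish empty        = leaf
  finish (st B Q _ _) = join B Q

  step : State → ℕ → State
  step empty        d = st nothing (one (mountain d)) nothing d
  step (st B Q p c) d =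
    if isBreak p c d then st (just (join B Q)) (one (mountain d)) (just c) d
                     else st B (two Q (mountain d)) (just c) d

  groups-head : ∀ p c rs → ∃₂ λ g gs → groups p c rs ≡ (c ∷ g) ∷ gs
  groups-head p c []       = [] , [] , refl
  groups-head p c (d ∷ rs) with isBreak p c d
  ... | true  = [] , _ , refl
  ... | false with groups (just c) d rs
  ...   | []     = [] , [] , refl
  ...   | g ∷ gs = g , gs , refl

  -- The head `c` of the first group is skipped because its mountain is already the last peak of the
  -- open chain `Q`.
  assemble : Maybe Tree → Tree → List (List ℕ) → Tree
  assemble B Q ((c ∷ g) ∷ gs) =
    chainFrom (join B (chainFrom Q (map mountain g))) (map rangeRoot gs)
  assemble B Q _              = join B Q

  finish-foldl : ∀ B Q p c rs →
    finish (foldl step (st B Q p c) rs) ≡ assemble B Q (groups p c rs)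
  finish-foldl B Q p c []       = refl
  finish-foldl B Q p c (d ∷ rs) with isBreak p c d | groups-head (just c) d rs
  ... | true  | g , gs , eq
    rewrite finish-foldl (just (join B Q)) (one (mountain d)) (just c) d rs | eq = refl
  ... | false | g , gs , eq
    rewrite finish-foldl B (two Q (mountain d)) (just c) d rs | eq = refl

  mmb-foldl : ∀ hs → chain (map rangeRoot (ranges hs)) ≡ finish (foldl step empty hs)
  mmb-foldl []       = refl
  mmb-foldl (c ∷ rs) with groups-head nothing c rs
  ... | g , gs , eq
    rewrite finish-foldl nothing (one (mountain c)) nothing c rs | eq = refl

  -- A right fold over the reversed heights: the lowest digit is the last mountain scanned, so
  -- deleting it undoes exactly one `step`.
  state : ℕ → List Bool → State
  state i bs = foldr (flip step) empty (heightsFrom i bs)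

  mmb-state : ∀ n → mmb n ≡ finish (state 0 (digits n))
  mmb-state n = begin
    mmb n                                          ≡⟨ mmb-foldl (heights n) ⟩
    finish (foldl step empty (heights n))          ≡⟨ cong finish (reverse-foldl step empty (heightsRev n)) ⟩
    finish (foldr (flip step) empty (heightsRev n)) ≡⟨ cong (finish ∘ foldr (flip step) empty) (heightsRev-digits n) ⟩
    finish (state 0 (digits n))                    ∎
    where open ≡-Reasoning

  -- Range breaks read off the digits.

  -- Whether a range ends between mountains i + 1 and i, from digits i, i + 1 and i + 2 of n + 1.
  break : Bool → Bool → Bool → Bool
  break b₀ b₁ b₂ = b₁ ∧ not (b₀ ∧ b₂)

  -- The heights differ by 2 exactly when `b₁` is 1 and `b₀` is 0; mountains `i + 2` and `i + 1` are
  -- level exactly when `b₁` is 1 and `b₂` is 0. Only differences matter, hence the descent to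
  -- `i = 0`.
  isBreak-digits : ∀ i b₀ b₁ b₂ →
    isBreak (just (bit b₂ + suc (suc i))) (bit b₁ + suc i) (bit b₀ + i) ≡ break b₀ b₁ b₂
  isBreak-digits zero    false false false = refl
  isBreak-digits zero    false false true  = refl
  isBreak-digits zero    false true  false = refl
  isBreak-digits zero    false true  true  = refl
  isBreak-digits zero    true  false false = refl
  isBreak-digits zero    true  false true  = refl
  isBreak-digits zero    true  true  false = refl
  isBreak-digits zero    true  true  true  = refl
  isBreak-digits (suc i) false false false = isBreak-digits i false false false
  isBreak-digits (suc i) false false true  = isBreak-digits i false false true
  isBreak-digits (suc i) false true  false = isBreak-digits i false true  false
  isBreak-digits (suc i) false true  true  = isBreak-digits i false true  true
  isBreak-digits (suc i) true  false false = isBreak-digits i true  false false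
  isBreak-digits (suc i) true  false true  = isBreak-digits i true  false true
  isBreak-digits (suc i) true  true  false = isBreak-digits i true  true  false
  isBreak-digits (suc i) true  true  true  = isBreak-digits i true  true  true

  isBreak-first : ∀ i → isBreak nothing (suc (suc i)) i ≡ true
  isBreak-first zero    = refl
  isBreak-first (suc i) = isBreak-first i

  belt : State → Maybe Tree
  belt empty        = nothing
  belt (st B _ _ _) = B

  state-shape : ∀ i b₀ b₁ bs → ∃₂ λ B Q →
    state i (b₀ ∷ b₁ ∷ bs) ≡ st B Q (just (bit b₁ + suc i)) (bit b₀ + i)
  state-shape i b₀ b₁ [] with isBreak nothing (bit b₁ + suc i) (bit b₀ + i)
  ... | true  = _ , _ , refl
  ... | false = _ , _ , refl
  state-shape i b₀ b₁ (b₂ ∷ bs) with state-shape (suc i) b₁ b₂ bs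
  ... | B , Q , eq rewrite eq with isBreak (just (bit b₂ + suc (suc i))) (bit b₁ + suc i) (bit b₀ + i)
  ...   | true  = _ , _ , refl
  ...   | false = _ , _ , refl

  Constant : List Bool → Set
  Constant bs = ∃ λ c → All (_≡ c) bs

  belt-step : ∀ B Q p c d → belt (step (st B Q p c) d) ≡ nothing →
    isBreak p c d ≡ false × B ≡ nothing
  belt-step B Q p c d h with isBreak p c d
  ... | false = refl , h

  belt-state : ∀ i b₀ b₁ b₂ bs → belt (state i (b₀ ∷ b₁ ∷ b₂ ∷ bs)) ≡ nothing →
    break b₀ b₁ b₂ ≡ false × belt (state (suc i) (b₁ ∷ b₂ ∷ bs)) ≡ nothing
  belt-state i b₀ b₁ b₂ bs h with state-shape (suc i) b₁ b₂ bs
  ... | B , Q , eq rewrite eq with belt-step B Q (just (bit b₂ + suc (suc i))) (bit b₁ + suc i) (bit b₀ + i) h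
  ...   | nb , B≡ = trans (sym (isBreak-digits i b₀ b₁ b₂)) nb , B≡

  -- The hypothesis says that there is only one range.
  belt-nothing⇒constant : ∀ i b bs → belt (state i (b ∷ bs)) ≡ nothing → Constant bs
  belt-nothing⇒constant i b₀ []        h = true , []
  belt-nothing⇒constant i b₀ (b₁ ∷ []) h = b₁ , refl ∷ []
  belt-nothing⇒constant i b₀ (b₁ ∷ bs@(b₂ ∷ bs′)) h =
    prepend (agree b₀ b₁ b₂ bs′ nb h′) (belt-nothing⇒constant (suc i) b₁ bs h′)
    where
    nb = proj₁ (belt-state i b₀ b₁ b₂ bs′ h)
    h′ = proj₂ (belt-state i b₀ b₁ b₂ bs′ h)
    prepend : ∀ {b₁ b₂ bs} → b₁ ≡ b₂ → Constant (b₂ ∷ bs) → Constant (b₁ ∷ b₂ ∷ bs)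
    prepend refl (c , p ∷ ps) = c , p ∷ p ∷ ps
    agree : ∀ b₀ b₁ b₂ bs → break b₀ b₁ b₂ ≡ false →
            belt (state (suc i) (b₁ ∷ b₂ ∷ bs)) ≡ nothing → b₁ ≡ b₂
    agree b₀   false false bs        nb h = refl
    -- Digits 0 and 1 at positions `i + 1` and `i + 2` give heights `i + 1` and `i + 3`: a break one
    -- boundary further up, whether or not a higher mountain exists.
    agree b₀   false true  []        nb h =
      contradiction (trans (sym (isBreak-first i)) (proj₁ (belt-step nothing (one (mountain j)) nothing j (suc i) h))) λ ()
      where j = suc (suc (suc i))
    agree b₀   false true  (b₃ ∷ bs) nb h =
      contradiction (proj₁ (belt-state (suc i) false true b₃ bs h)) λ ()
    agree true true  true  bs        nb h = refl

  -- Hash counts when a mountain is added at the right end.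

  leaves≥1 : ∀ t → 1 ≤ leaves t
  leaves≥1 leaf      = s≤s z≤n
  leaves≥1 (one t)   = leaves≥1 t
  leaves≥1 (two l r) = ≤-trans (leaves≥1 l) (m≤m+n (leaves l) (leaves r))

  leaves-mountain : ∀ s → leaves (mountain s) ≡ 2 ^ s
  leaves-mountain zero    = refl
  leaves-mountain (suc s) rewrite leaves-mountain s = cong (2 ^ s +_) (sym (+-identityʳ (2 ^ s)))

  <⇒<ᵇ-true : ∀ {m n} → m < n → (m <ᵇ n) ≡ true
  <⇒<ᵇ-true {m} {n} m<n with m <ᵇ n | <⇒<ᵇ m<n
  ... | true | _ = refl

  ≥⇒<ᵇ-false : ∀ {m n} → n ≤ m → (m <ᵇ n) ≡ false
  ≥⇒<ᵇ-false {m} {n} n≤m with m <ᵇ n in eq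
  ... | false = refl
  ... | true  = contradiction n≤m (<⇒≱ (<ᵇ⇒< m n (subst T (sym eq) tt)))

  -- Leaves are now counted from the right, starting with 1.
  proofSizeʳ : Tree → ℕ → ℕ
  proofSizeʳ t k = proofSize t (leaves t ∸ k)

  proofSizeʳ-right : ∀ l r {k} → k ≤ leaves r → proofSizeʳ (two l r) k ≡ suc (proofSizeʳ r k)
  proofSizeʳ-right l r {k} k≤
    rewrite +-∸-assoc (leaves l) k≤
          | ≥⇒<ᵇ-false (m≤m+n (leaves l) (leaves r ∸ k))
          | m+n∸m≡n (leaves l) (leaves r ∸ k) = refl

  m∸n<m : ∀ {m n} → 1 ≤ m → 1 ≤ n → m ∸ n < m
  m∸n<m {suc m} {suc n} _ _ = s≤s (m∸n≤m m n)

  proofSizeʳ-left : ∀ l r {k} → 1 ≤ k → proofSizeʳ (two l r) (leaves r + k) ≡ suc (proofSizeʳ l k)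
  proofSizeʳ-left l r {k} 1≤k
    rewrite +-comm (leaves l) (leaves r)
          | [m+n]∸[m+o]≡n∸o (leaves r) (leaves l) k
          | <⇒<ᵇ-true {leaves l ∸ k} {leaves l}
              (m∸n<m (leaves≥1 l) 1≤k)
    = refl

  proofSizeʳ-mountain : ∀ s {k} → 1 ≤ k → k ≤ 2 ^ s → proofSizeʳ (mountain s) k ≡ s
  proofSizeʳ-mountain zero    1≤k k≤ = refl
  proofSizeʳ-mountain (suc s) {k} 1≤k k≤ with k ≤? 2 ^ s
  ... | yes k≤2^s =
    trans (proofSizeʳ-right (mountain s) (mountain s) (subst (k ≤_) (sym (leaves-mountain s)) k≤2^s))
          (cong suc (proofSizeʳ-mountain s 1≤k k≤2^s))
  ... | no  k≰2^s = begin
    proofSizeʳ (mountain (suc s)) k                       ≡⟨ cong (proofSizeʳ (mountain (suc s))) k≡ ⟩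
    proofSizeʳ (mountain (suc s)) (leaves (mountain s) + j) ≡⟨ proofSizeʳ-left (mountain s) (mountain s) 1≤j ⟩
    suc (proofSizeʳ (mountain s) j)                       ≡⟨ cong suc (proofSizeʳ-mountain s 1≤j j≤) ⟩
    suc s                                                 ∎
    where
    open ≡-Reasoning
    j = k ∸ 2 ^ s
    1≤j : 1 ≤ j
    1≤j = m<n⇒0<n∸m (≰⇒> k≰2^s)
    k≡ : k ≡ leaves (mountain s) + j
    k≡ rewrite leaves-mountain s = sym (m+[n∸m]≡n (<⇒≤ (≰⇒> k≰2^s)))
    j≤ : j ≤ 2 ^ s
    j≤ = m≤n+o⇒m∸n≤o k (2 ^ s) (subst (λ z → k ≤ 2 ^ s + z) (+-identityʳ (2 ^ s)) k≤)

  -- The last index is 1 or 0 according as leaf k (from the right) lies in the last range.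
  data Located : State → ℕ → ℕ → Set where
    inside  : ∀ {B Q p c k} → k ≤ leaves Q → Located (st B Q p c) k 1
    outside : ∀ {B Q p c k} → leaves Q < k → Located (st (just B) Q p c) k 0

  -- A break puts one more belt node above every older leaf. Without a break the new mountain
  -- lengthens the last range: leaves of that range (`v = 1`) gain one sibling, while leaves of
  -- earlier ranges only see a sibling range root replaced.
  step-older : ∀ {s d k v} β → 1 ≤ k →
    (∀ {B Q p c} → s ≡ st B Q p c → isBreak p c d ≡ β) → Located s k v →
    proofSizeʳ (finish (step s d)) (2 ^ d + k) ≡ bit β + bit (not β) * v + proofSizeʳ (finish s) k
    × Located (step s d) (2 ^ d + k) (bit (not β) * v)
  step-older {s} {d} {k} β 1≤k br loc rewrite sym (leaves-mountain d) = go β br loc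
    where
    m = mountain d
    go : ∀ {s v} β → (∀ {B Q p c} → s ≡ st B Q p c → isBreak p c d ≡ β) → Located s k v →
      proofSizeʳ (finish (step s d)) (leaves m + k) ≡ bit β + bit (not β) * v + proofSizeʳ (finish s) k
      × Located (step s d) (leaves m + k) (bit (not β) * v)
    go true br (inside {B} {Q} k≤) rewrite br refl =
      proofSizeʳ-left (join B Q) (one m) 1≤k , outside (m<m+n (leaves m) 1≤k)
    go true br (outside {B} {Q} k>) rewrite br refl =
      proofSizeʳ-left (two B Q) (one m) 1≤k , outside (m<m+n (leaves m) 1≤k)
    go false br (inside {nothing} {Q} k≤) rewrite br refl =
      proofSizeʳ-left Q m 1≤k , inside (bound Q k≤)
      where
      bound : ∀ Q → k ≤ leaves Q → leaves m + k ≤ leaves (two Q m)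
      bound Q k≤ rewrite +-comm (leaves Q) (leaves m) = +-monoʳ-≤ (leaves m) k≤
    go false br (inside {just B} {Q} k≤) rewrite br refl =
      trans (proofSizeʳ-right B (two Q m) bound)
        (cong suc (trans (proofSizeʳ-left Q m 1≤k) (sym (proofSizeʳ-right B Q k≤))))
      , inside bound
      where
      bound : leaves m + k ≤ leaves (two Q m)
      bound rewrite +-comm (leaves Q) (leaves m) = +-monoʳ-≤ (leaves m) k≤
    go false br (outside {B} {Q} k>) rewrite br refl =
      older , outside (subst (_< leaves m + k) (+-comm (leaves m) (leaves Q)) (+-monoʳ-< (leaves m) k>))
      where
      j = k ∸ leaves Q
      k≡ : leaves Q + j ≡ k
      k≡ = m+[n∸m]≡n (<⇒≤ k>)
      1≤j : 1 ≤ j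
      1≤j = m<n⇒0<n∸m k>
      older : proofSizeʳ (two B (two Q m)) (leaves m + k) ≡ proofSizeʳ (two B Q) k
      older = begin
        proofSizeʳ (two B (two Q m)) (leaves m + k)
          ≡⟨ cong (proofSizeʳ (two B (two Q m))) (begin
               leaves m + k              ≡⟨ cong (leaves m +_) (sym k≡) ⟩
               leaves m + (leaves Q + j) ≡⟨ solve 3 (λ x y z → x :+ (y :+ z) := y :+ x :+ z) refl (leaves m) (leaves Q) j ⟩
               leaves (two Q m) + j      ∎) ⟩
        proofSizeʳ (two B (two Q m)) (leaves (two Q m) + j)
          ≡⟨ proofSizeʳ-left B (two Q m) 1≤j ⟩
        suc (proofSizeʳ B j)
          ≡⟨ sym (proofSizeʳ-left B Q 1≤j) ⟩
        proofSizeʳ (two B Q) (leaves Q + j)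
          ≡⟨ cong (proofSizeʳ (two B Q)) k≡ ⟩
        proofSizeʳ (two B Q) k ∎
        where open ≡-Reasoning

  -- One hash per level of the mountain, one for the range sibling unless the mountain opens a
  -- range, and one for the belt sibling of the range root. The last is missing in the first range,
  -- whose root is an only child: this is the second alternative.
  step-newest : ∀ {B Q p c d k} β → 1 ≤ k → k ≤ 2 ^ d → isBreak p c d ≡ β →
    let s = st B Q p c ; σ′ = proofSizeʳ (finish (step s d)) k in
    (σ′ ≡ suc (d + bit (not β)) ⊎ suc σ′ ≡ suc (d + bit (not β)) × belt (step s d) ≡ nothing)
    × Located (step s d) k 1
  step-newest {B} {Q} {d = d} {k} true 1≤k k≤ br rewrite br | +-identityʳ d =
    inj₁ (trans (proofSizeʳ-right (join B Q) (one (mountain d)) k≤′) (cong suc (proofSizeʳ-mountain d 1≤k k≤)))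
    , inside k≤′
    where
    k≤′ : k ≤ leaves (mountain d)
    k≤′ = subst (k ≤_) (sym (leaves-mountain d)) k≤
  step-newest {B} {Q} {d = d} {k} false 1≤k k≤ br rewrite br | +-comm d 1 = size B , inside k≤″
    where
    k≤′ : k ≤ leaves (mountain d)
    k≤′ = subst (k ≤_) (sym (leaves-mountain d)) k≤
    k≤″ : k ≤ leaves (two Q (mountain d))
    k≤″ = ≤-trans k≤′ (m≤n+m _ (leaves Q))
    range : proofSizeʳ (two Q (mountain d)) k ≡ suc d
    range = trans (proofSizeʳ-right Q (mountain d) k≤′) (cong suc (proofSizeʳ-mountain d 1≤k k≤))
    size : ∀ B → proofSizeʳ (join B (two Q (mountain d))) k ≡ suc (suc d)
         ⊎ suc (proofSizeʳ (join B (two Q (mountain d))) k) ≡ suc (suc d) × B ≡ nothing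
    size nothing  = inj₂ (cong suc range , refl)
    size (just B) = inj₁ (trans (proofSizeʳ-right B (two Q (mountain d)) k≤″) (cong suc range))

  -- Removal of the lowest mountain.

  odd : ℕ → Bool
  odd zero          = false
  odd (suc zero)    = true
  odd (suc (suc n)) = odd n

  odd+half : ∀ n → n ≡ bit (odd n) + (⌊ n /2⌋ + ⌊ n /2⌋)
  odd+half zero          = refl
  odd+half (suc zero)    = refl
  odd+half (suc (suc n)) = begin
    2 + n                                          ≡⟨ cong (2 +_) (odd+half n) ⟩
    2 + (bit (odd n) + (⌊ n /2⌋ + ⌊ n /2⌋))        ≡⟨ solve 2 (λ b h → con 2 :+ (b :+ (h :+ h)) := b :+ ((con 1 :+ h) :+ (con 1 :+ h))) refl (bit (odd n)) ⌊ n /2⌋ ⟩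
    bit (odd n) + (suc ⌊ n /2⌋ + suc ⌊ n /2⌋)      ∎
    where open ≡-Reasoning

  -- Mountain 0 holds 1 + b leaves, b being the lowest digit of n + 1.  The k-th
  -- newest leaf lies in it iff next b k = 0; otherwise it is a descendant of the
  -- (next b k)-th newest leaf of the MMB of all other mountains lowered by one.
  next : Bool → ℕ → ℕ
  next b k = ⌊ k ∸ bit b /2⌋

  -- A view of zero-based leaf numbers: past the `1 + b` leaves of mountain 0 the number becomes
  -- `κ`, and halving `κ` gives the zero-based number in the lowered problem, where two leaves
  -- become one.
  data Position (b : Bool) : ℕ → Set where
    newest : ∀ {κ} → κ ≤ bit b → next b (suc κ) ≡ 0 → Position b κ
    older  : ∀ κ → next b (suc (suc (bit b + κ))) ≡ suc ⌊ κ /2⌋ → Position b (suc (bit b + κ))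

  position : ∀ b κ → Position b κ
  position false zero          = newest z≤n refl
  position false (suc κ)       = older κ refl
  position true  zero          = newest z≤n refl
  position true  (suc zero)    = newest (s≤s z≤n) refl
  position true  (suc (suc κ)) = older κ refl

  -- Whether the k-th newest item lies in the last range, from the low digits of n + 1;
  -- the value on short lists is irrelevant.
  inLastRange : ℕ → List Bool → ℕ
  inLastRange k (b₀ ∷ bs@(b₁ ∷ b₂ ∷ _)) =
    if next b₀ k ≡ᵇ 0 then 1 else bit (not (break b₀ b₁ b₂)) * inLastRange (next b₀ k) bs
  inLastRange k _ = 0

  -- The proof size of an item outside the first range.
  size : ℕ → List Bool → ℕ
  size k (b₀ ∷ bs@(b₁ ∷ b₂ ∷ _)) =
    if next b₀ k ≡ᵇ 0
    then suc (bit b₀ + bit (not (break b₀ b₁ b₂)))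
    else suc (bit (break b₀ b₁ b₂) + inLastRange k (b₀ ∷ bs) + size (next b₀ k) bs)
  size k _ = 0

  -- The i lowest mountains have been removed; 2^i κ + ρ is the number of the leaf
  -- among the remaining ones, and each leaf of the reduced problem stands for 2^i leaves.
  proofSizeʳ-size : ∀ i l u w κ ρ → length u ≡ 2 + l → suc κ < 2 ^ l → 1 ≤ ρ → ρ ≤ 2 ^ i →
    let s = state i (u ++ w) ; k = 2 ^ i * κ + ρ in
    (proofSizeʳ (finish s) k ≡ i + size (suc κ) u
      ⊎ suc (proofSizeʳ (finish s) k) ≡ i + size (suc κ) u × Constant w)
    × Located s k (inLastRange (suc κ) u)
  -- Each removal at least halves `suc κ`, so `l` digits reach the mountain of the leaf; the two
  -- spare digits are those that `break` still reads there.
  proofSizeʳ-size i zero u w κ ρ len (s≤s ()) 1≤ρ ρ≤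
  proofSizeʳ-size i (suc l) (b₀ ∷ []) w κ ρ () κ< 1≤ρ ρ≤
  proofSizeʳ-size i (suc l) (b₀ ∷ b₁ ∷ []) w κ ρ () κ< 1≤ρ ρ≤
  proofSizeʳ-size i (suc l) (b₀ ∷ bs@(b₁ ∷ b₂ ∷ r)) w κ ρ len κ< 1≤ρ ρ≤ with position b₀ κ
  ... | newest κ≤ eq rewrite eq with state-shape (suc i) b₁ b₂ (r ++ w)
  ...   | B , Q , eqₛ = go (step-newest {B} {Q} {just (bit b₂ + suc (suc i))} β 1≤k k≤ (isBreak-digits i b₀ b₁ b₂))
    where
    β = break b₀ b₁ b₂
    d = bit b₀ + i
    k = 2 ^ i * κ + ρ
    1≤k : 1 ≤ k
    1≤k = ≤-trans 1≤ρ (m≤n+m ρ (2 ^ i * κ))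
    k≤ : k ≤ 2 ^ d
    k≤ = begin
      2 ^ i * κ + ρ           ≤⟨ +-mono-≤ (*-monoʳ-≤ (2 ^ i) κ≤) ρ≤ ⟩
      2 ^ i * bit b₀ + 2 ^ i  ≡⟨ double b₀ ⟩
      2 ^ d                   ∎
      where
      open ≤-Reasoning
      double : ∀ b → 2 ^ i * bit b + 2 ^ i ≡ 2 ^ (bit b + i)
      double false rewrite *-zeroʳ (2 ^ i) = refl
      double true  = solve 1 (λ x → x :* con 1 :+ x := x :+ (x :+ con 0)) refl (2 ^ i)
    s = st B Q (just (bit b₂ + suc (suc i))) (bit b₁ + suc i)
    reorder : suc (d + bit (not β)) ≡ i + suc (bit b₀ + bit (not β))
    reorder = solve 3 (λ b i n → con 1 :+ (b :+ i :+ n) := i :+ (con 1 :+ (b :+ n))) refl (bit b₀) i (bit (not β))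
    go : let σ′ = proofSizeʳ (finish (step s d)) k in
      (σ′ ≡ suc (d + bit (not β)) ⊎ suc σ′ ≡ suc (d + bit (not β)) × belt (step s d) ≡ nothing)
        × Located (step s d) k 1 →
      let σ″ = proofSizeʳ (finish (state i (b₀ ∷ bs ++ w))) k in
      (σ″ ≡ i + suc (bit b₀ + bit (not β)) ⊎ suc σ″ ≡ i + suc (bit b₀ + bit (not β)) × Constant w)
        × Located (state i (b₀ ∷ bs ++ w)) k 1
    go (inj₁ p , loc) rewrite eqₛ = inj₁ (trans p reorder) , loc
    go (inj₂ (p , h) , loc) with belt-nothing⇒constant i b₀ (bs ++ w) (trans (cong (λ s → belt (step s d)) eqₛ) h)
    ... | c , cs rewrite eqₛ = inj₂ (trans p reorder , c , ++⁻ʳ bs cs) , loc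
  proofSizeʳ-size i (suc l) (b₀ ∷ bs@(b₁ ∷ b₂ ∷ r)) w .(suc (bit b₀ + κ)) ρ len κ< 1≤ρ ρ≤
      | older κ eq rewrite eq = go (proofSizeʳ-size (suc i) l bs w κ′ ρ′ (cong pred len) κ′< 1≤ρ′ ρ′≤)
    where
    open ≤-Reasoning
    β = break b₀ b₁ b₂
    d = bit b₀ + i
    -- The parity of `κ` moves into the residue: `κ = c + 2 κ′`, so
    -- `2 ^ i * κ + ρ = 2 ^ suc i * κ′ + ρ′`.
    κ′ = ⌊ κ /2⌋
    c = bit (odd κ)
    ρ′ = 2 ^ i * c + ρ
    k′ = 2 ^ suc i * κ′ + ρ′
    c≤1 : ∀ b → bit b ≤ 1
    c≤1 false = z≤n
    c≤1 true  = s≤s z≤n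
    1≤ρ′ : 1 ≤ ρ′
    1≤ρ′ = ≤-trans 1≤ρ (m≤n+m ρ (2 ^ i * c))
    ρ′≤ : ρ′ ≤ 2 ^ suc i
    ρ′≤ = begin
      2 ^ i * c + ρ      ≤⟨ +-mono-≤ (*-monoʳ-≤ (2 ^ i) (c≤1 (odd κ))) ρ≤ ⟩
      2 ^ i * 1 + 2 ^ i  ≡⟨ solve 1 (λ x → x :* con 1 :+ x := x :+ (x :+ con 0)) refl (2 ^ i) ⟩
      2 ^ suc i          ∎
    κ′< : suc κ′ < 2 ^ l
    κ′< = *-cancelˡ-< 2 (suc κ′) (2 ^ l) (begin-strict
      2 * suc κ′                  ≡⟨ solve 1 (λ h → con 2 :* (con 1 :+ h) := con 2 :+ (h :+ h)) refl κ′ ⟩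
      2 + (κ′ + κ′)               ≤⟨ +-monoʳ-≤ 2 (m≤n+m (κ′ + κ′) (bit b₀ + c)) ⟩
      2 + (bit b₀ + c + (κ′ + κ′)) ≡⟨ cong (2 +_) (+-assoc (bit b₀) c (κ′ + κ′)) ⟩
      2 + (bit b₀ + (c + (κ′ + κ′))) ≡⟨ cong (λ z → 2 + (bit b₀ + z)) (sym (odd+half κ)) ⟩
      2 + (bit b₀ + κ)            <⟨ κ< ⟩
      2 ^ suc l                   ∎)
    k≡ : 2 ^ i * suc (bit b₀ + κ) + ρ ≡ 2 ^ d + k′
    k≡ = begin-equality
      2 ^ i * suc (bit b₀ + κ) + ρ
        ≡⟨ cong (λ z → 2 ^ i * suc (bit b₀ + z) + ρ) (odd+half κ) ⟩
      2 ^ i * suc (bit b₀ + (c + (κ′ + κ′))) + ρ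
        ≡⟨ solve 5 (λ x b c h r → x :* (con 1 :+ (b :+ (c :+ (h :+ h)))) :+ r
                     := (con 1 :+ b) :* x :+ ((x :+ (x :+ con 0)) :* h :+ (x :* c :+ r)))
             refl (2 ^ i) (bit b₀) c κ′ ρ ⟩
      suc (bit b₀) * 2 ^ i + k′
        ≡⟨ cong (_+ k′) (double b₀) ⟩
      2 ^ d + k′ ∎
      where
      double : ∀ b → suc (bit b) * 2 ^ i ≡ 2 ^ (bit b + i)
      double false = +-identityʳ (2 ^ i)
      double true  = refl
    s = state (suc i) (bs ++ w)
    isBreak≡ : ∀ {B Q p c} → s ≡ st B Q p c → isBreak p c d ≡ β
    isBreak≡ eqₛ with state-shape (suc i) b₁ b₂ (r ++ w)
    ... | B , Q , eqₛ′ with trans (sym eqₛ) eqₛ′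
    ...   | refl = isBreak-digits i b₀ b₁ b₂
    v = inLastRange (suc κ′) bs
    a = bit β + bit (not β) * v
    total = i + suc (a + size (suc κ′) bs)
    reorder : a + (suc i + size (suc κ′) bs) ≡ total
    reorder = solve 3 (λ a i z → a :+ (con 1 :+ i :+ z) := i :+ (con 1 :+ (a :+ z))) refl a i (size (suc κ′) bs)
    go : let σ′ = proofSizeʳ (finish s) k′ in
      (σ′ ≡ suc i + size (suc κ′) bs ⊎ suc σ′ ≡ suc i + size (suc κ′) bs × Constant w)
        × Located s k′ v →
      let k = 2 ^ i * suc (bit b₀ + κ) + ρ ; σ″ = proofSizeʳ (finish (step s d)) k in
      (σ″ ≡ total ⊎ suc σ″ ≡ total × Constant w) × Located (step s d) k (bit (not β) * v)
    go (σ≡ , loc) rewrite k≡ with step-older {d = d} β (≤-trans 1≤ρ′ (m≤n+m ρ′ (2 ^ suc i * κ′))) isBreak≡ loc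
    go (inj₁ p , loc) | q , loc′ = inj₁ (trans q (trans (cong (a +_) p) reorder)) , loc′
    go (inj₂ (p , h) , loc) | q , loc′ =
      inj₂ (trans (cong suc q) (trans (sym (+-suc a _)) (trans (cong (a +_) p) reorder)) , h) , loc′

  -- Leaf counts and the low digits of `n + 1`.

  count : State → ℕ
  count empty        = 0
  count (st B Q _ _) = leaves (join B Q)

  -- Uniform in `s` because `count empty` is 0, whereas `finish empty` is a dummy leaf.
  count-step : ∀ s d → count (step s d) ≡ count s + 2 ^ d
  count-step empty d = leaves-mountain d
  count-step (st B Q p c) d with isBreak p c d
  ... | true  = cong (leaves (join B Q) +_) (leaves-mountain d)
  ... | false with B
  ...   | nothing = cong (leaves Q +_) (leaves-mountain d)
  ...   | just B′ = trans (cong (λ z → leaves B′ + (leaves Q + z)) (leaves-mountain d)) (sym (+-assoc (leaves B′) _ _))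

  -- The summand `2 ^ i` is the 1 of `n + 1`, in units of the lowest position; each mountain
  -- satisfies `2 ^ (b + i) + 2 ^ i = b * 2 ^ i + 2 ^ suc i`.
  count-state : ∀ i bs → count (state i bs) + 2 ^ i ≡ 2 ^ i * value bs
  count-state i []       = sym (*-identityʳ (2 ^ i))
  count-state i (b ∷ bs) = begin
    count (step s (bit b + i)) + x      ≡⟨ cong (_+ x) (count-step s (bit b + i)) ⟩
    count s + 2 ^ (bit b + i) + x       ≡⟨ double b ⟩
    bit b * x + (count s + (x + (x + 0))) ≡⟨ cong (bit b * x +_) (count-state (suc i) bs) ⟩
    bit b * x + (x + (x + 0)) * value bs ≡⟨ solve 3 (λ b x v → b :* x :+ (x :+ (x :+ con 0)) :* v := x :* (b :+ (v :+ v))) refl (bit b) x (value bs) ⟩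
    x * value (b ∷ bs)                   ∎
    where
    open ≡-Reasoning
    x = 2 ^ i
    s = state (suc i) bs
    double : ∀ b → count s + 2 ^ (bit b + i) + x ≡ bit b * x + (count s + (x + (x + 0)))
    double false = solve 2 (λ c x → c :+ x :+ x := c :+ (x :+ (x :+ con 0))) refl (count s) x
    double true  = solve 2 (λ c x → c :+ (x :+ (x :+ con 0)) :+ x := x :+ con 0 :+ (c :+ (x :+ (x :+ con 0)))) refl (count s) x

  leaves-finish : ∀ s d → leaves (finish (step s d)) ≡ count (step s d)
  leaves-finish empty d = refl
  leaves-finish (st B Q p c) d with isBreak p c d
  ... | true  = refl
  ... | false = refl

  leaves-mmb : ∀ n → 1 ≤ n → leaves (mmb n) ≡ n
  leaves-mmb (suc n) _ rewrite mmb-state (suc n) = suc-injective (begin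
    suc (leaves (finish (state 0 bs)))  ≡⟨ cong suc (nonempty (digits n)) ⟩
    suc (count (state 0 bs))            ≡⟨ +-comm 1 _ ⟩
    count (state 0 bs) + 1              ≡⟨ count-state 0 bs ⟩
    value bs + 0                        ≡⟨ +-identityʳ _ ⟩
    value bs                            ≡⟨ value-digits (suc n) ⟩
    suc (suc n)                         ∎)
    where
    open ≡-Reasoning
    bs = digits (suc n)
    nonempty : ∀ cs → leaves (finish (state 0 (increment cs))) ≡ count (state 0 (increment cs))
    nonempty []           = refl
    nonempty (false ∷ cs) = leaves-finish (state 1 cs) 1
    nonempty (true  ∷ cs) = leaves-finish (state 1 (increment cs)) 0

  -- Periodic in `N`, unlike `digits`; the two agree as soon as `digits` is long enough.
  lowDigits : ℕ → ℕ → List Bool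
  lowDigits zero    N = []
  lowDigits (suc d) N = odd N ∷ lowDigits d ⌊ N /2⌋

  odd-value : ∀ b v → odd (bit b + (v + v)) ≡ b
  odd-value false zero    = refl
  odd-value true  zero    = refl
  odd-value false (suc v) rewrite +-suc v v = odd-value false v
  odd-value true  (suc v) rewrite +-suc v v = odd-value true v

  half-value : ∀ b v → ⌊ bit b + (v + v) /2⌋ ≡ v
  half-value false v = sym (n≡⌊n+n/2⌋ v)
  half-value true  v = sym (n≡⌈n+n/2⌉ v)

  lowDigits-value : ∀ d bs → d ≤ length bs → lowDigits d (value bs) ≡ take d bs
  lowDigits-value zero    bs       d≤       = refl
  lowDigits-value (suc d) (b ∷ bs) (s≤s d≤)
    rewrite odd-value b (value bs) | half-value b (value bs) = cong (b ∷_) (lowDigits-value d bs d≤)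

  constantly : Bool → List Bool → ℕ
  constantly c     []           = 1
  constantly false (false ∷ bs) = constantly false bs
  constantly true  (true  ∷ bs) = constantly true bs
  constantly _     (_     ∷ bs) = 0

  constantly-All : ∀ {c bs} → All (_≡ c) bs → constantly c bs ≡ 1
  constantly-All                 []          = refl
  constantly-All {false} {_ ∷ _} (refl ∷ ps) = constantly-All ps
  constantly-All {true}  {_ ∷ _} (refl ∷ ps) = constantly-All ps

  -- A numeric majorant of the indicator of `Constant`, so that the exceptional items can be summed.
  flat : List Bool → ℕ
  flat bs = constantly false bs + constantly true bs

  flat-Constant : ∀ {bs} → Constant bs → 1 ≤ flat bs
  flat-Constant {bs} (false , cs) rewrite constantly-All cs = s≤s z≤n
  flat-Constant {bs} (true  , cs) rewrite constantly-All cs = m≤n+m 1 (constantly false bs)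

  drop-take-All : ∀ {P : Bool → Set} m n bs → All P (drop m bs) → All P (drop m (take n bs))
  drop-take-All zero    n       bs       ps = take⁺ n ps
  drop-take-All (suc m) zero    bs       ps = []
  drop-take-All (suc m) (suc n) []       ps = []
  drop-take-All (suc m) (suc n) (b ∷ bs) ps = drop-take-All m n bs ps

  length-digits : ∀ m n → 2 ^ m ≤ suc n → m ≤ length (digits n)
  length-digits m n 2^m≤ = s≤s⁻¹ (≰⇒> λ len< → <⇒≱ (value<2^ (digits n)) (begin
    2 ^ suc (length (digits n)) ≤⟨ ^-monoʳ-≤ 2 len< ⟩
    2 ^ m                       ≤⟨ 2^m≤ ⟩
    suc n                       ≡⟨ sym (value-digits n) ⟩
    value (digits n)            ∎))
    where open ≤-Reasoning

  lowDigits-digits : ∀ d n → d ≤ length (digits n) → lowDigits d (suc n) ≡ take d (digits n)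
  lowDigits-digits d n d≤ =
    trans (cong (lowDigits d) (sym (value-digits n))) (lowDigits-value d (digits n) d≤)

  σ≡proofSizeʳ : ∀ k n → 1 ≤ n → σ k n ≡ proofSizeʳ (finish (state 0 (digits n))) k
  σ≡proofSizeʳ k n 1≤n = trans (cong (λ z → proofSize (mmb n) (z ∸ k)) (sym (leaves-mmb n 1≤n)))
                               (cong (λ t → proofSizeʳ t k) (mmb-state n))

  -- If all digits beyond the first `2 + l` agree, so do the next `L`. The error term thus depends
  -- on finitely many digits and has density `2 / 2 ^ L`, small for large `L`.
  σ≈size : ∀ l L κ n → suc κ < 2 ^ l → 2 ^ (2 + l + L) ≤ suc n →
    let s = size (suc κ) (lowDigits (2 + l) (suc n)) in
    σ (suc κ) n ≤ s × s ≤ σ (suc κ) n + flat (drop (2 + l) (lowDigits (2 + l + L) (suc n)))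
  σ≈size l L κ n κ< n≥ =
    subst₂ (λ v v′ → σ (suc κ) n ≤ size (suc κ) v × size (suc κ) v ≤ σ (suc κ) n + flat (drop (2 + l) v′))
      (sym (lowDigits-digits (2 + l) n (≤-trans (m≤m+n (2 + l) L) (length-digits (2 + l + L) n n≥))))
      (sym (lowDigits-digits (2 + l + L) n (length-digits (2 + l + L) n n≥)))
      (convert (proj₁ (proofSizeʳ-size 0 l u w κ 1 lenu κ< ≤-refl ≤-refl)))
    where
    bs = digits n
    u = take (2 + l) bs
    w = drop (2 + l) bs
    lenu : length u ≡ 2 + l
    lenu = trans (length-take (2 + l) bs)
      (m≤n⇒m⊓n≡m (≤-trans (m≤m+n (2 + l) L) (length-digits (2 + l + L) n n≥)))
    1≤n : 1 ≤ n
    1≤n = s≤s⁻¹ (≤-trans (^-monoʳ-≤ 2 {1} {2 + l + L} (s≤s z≤n)) n≥)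
    σ≡ : σ (suc κ) n ≡ proofSizeʳ (finish (state 0 (u ++ w))) (1 * κ + 1)
    σ≡ = trans (σ≡proofSizeʳ (suc κ) n 1≤n)
      (cong₂ (λ bs k → proofSizeʳ (finish (state 0 bs)) k) (sym (take++drop≡id (2 + l) bs))
             (solve 1 (λ κ → con 1 :+ κ := con 1 :* κ :+ con 1) refl κ))
    s = size (suc κ) u
    flatw = flat (drop (2 + l) (take (2 + l + L) bs))
    convert : (proofSizeʳ (finish (state 0 (u ++ w))) (1 * κ + 1) ≡ s
        ⊎ suc (proofSizeʳ (finish (state 0 (u ++ w))) (1 * κ + 1)) ≡ s × Constant w) →
      σ (suc κ) n ≤ s × s ≤ σ (suc κ) n + flatw
    convert (inj₁ p) rewrite trans σ≡ p = ≤-refl , m≤m+n s flatw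
    convert (inj₂ (p , c , cs)) = <⇒≤ (≤-reflexive p′) , (begin
      s                        ≡⟨ sym p′ ⟩
      suc (σ (suc κ) n)        ≡⟨ +-comm 1 _ ⟩
      σ (suc κ) n + 1          ≤⟨ +-monoʳ-≤ (σ (suc κ) n) (flat-Constant (c , drop-take-All (2 + l) (2 + l + L) bs cs)) ⟩
      σ (suc κ) n + flatw      ∎)
      where
      open ≤-Reasoning
      p′ : suc (σ (suc κ) n) ≡ s
      p′ = trans (cong suc σ≡) p

  -- Partial sums and sums over digit strings.

  partialSum : (ℕ → ℕ) → ℕ → ℕ
  partialSum f zero    = 0
  partialSum f (suc N) = f 0 + partialSum (f ∘ suc) N

  σsum-partialSum : ∀ k M → σsum k M ≡ partialSum (λ j → σ k (k + j)) (suc M)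
  σsum-partialSum k M = go (λ j → σ k (k + j)) id (suc M)
    where
    go : ∀ (f g : ℕ → ℕ) N → sum (map f (applyUpTo g N)) ≡ partialSum (f ∘ g) N
    go f g zero    = refl
    go f g (suc N) = cong (f (g 0) +_) (go f (g ∘ suc) N)

  partialSum-+ : ∀ f m N → partialSum f (m + N) ≡ partialSum f m + partialSum (f ∘ (m +_)) N
  partialSum-+ f zero    N = refl
  partialSum-+ f (suc m) N =
    trans (cong (f 0 +_) (partialSum-+ (f ∘ suc) m N)) (sym (+-assoc (f 0) _ _))

  partialSum-mono : ∀ {f g} → (∀ j → f j ≤ g j) → ∀ N → partialSum f N ≤ partialSum g N
  partialSum-mono f≤g zero    = z≤n
  partialSum-mono f≤g (suc N) = +-mono-≤ (f≤g 0) (partialSum-mono (λ j → f≤g (suc j)) N)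

  partialSum-add : ∀ f g N → partialSum (λ j → f j + g j) N ≡ partialSum f N + partialSum g N
  partialSum-add f g zero    = refl
  partialSum-add f g (suc N) rewrite partialSum-add (f ∘ suc) (g ∘ suc) N =
    solve 4 (λ a b c d → a :+ b :+ (c :+ d) := a :+ c :+ (b :+ d)) refl (f 0) (g 0) _ _

  partialSum-eventually : ∀ {f g} J → (∀ j → J ≤ j → f j ≤ g j) →
    ∀ N → partialSum f N ≤ partialSum g N + partialSum f J
  partialSum-eventually {f} {g} zero f≤g N =
    ≤-trans (partialSum-mono (λ j → f≤g j z≤n) N) (m≤m+n _ _)
  partialSum-eventually {f} {g} (suc J) f≤g zero    = z≤n
  partialSum-eventually {f} {g} (suc J) f≤g (suc N) = begin
    f 0 + partialSum (f ∘ suc) N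
      ≤⟨ +-monoʳ-≤ (f 0) (partialSum-eventually J (λ j J≤j → f≤g (suc j) (s≤s J≤j)) N) ⟩
    f 0 + (partialSum (g ∘ suc) N + partialSum (f ∘ suc) J)
      ≤⟨ m≤n+m _ (g 0) ⟩
    g 0 + (f 0 + (partialSum (g ∘ suc) N + partialSum (f ∘ suc) J))
      ≡⟨ solve 4 (λ a b c d → a :+ (b :+ (c :+ d)) := a :+ c :+ (b :+ d)) refl (g 0) (f 0) _ _ ⟩
    g 0 + partialSum (g ∘ suc) N + (f 0 + partialSum (f ∘ suc) J) ∎
    where open ≤-Reasoning

  partialSum-parity : ∀ (h : Bool → ℕ → ℕ) N →
    partialSum (λ n → h (odd n) ⌊ n /2⌋) N
      ≡ partialSum (h false) ⌈ N /2⌉ + partialSum (h true) ⌊ N /2⌋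
  partialSum-parity h zero          = refl
  partialSum-parity h (suc zero)    = sym (+-identityʳ _)
  partialSum-parity h (suc (suc N)) rewrite partialSum-parity (λ b n → h b (suc n)) N =
    solve 4 (λ a b c d → a :+ (b :+ (c :+ d)) := a :+ c :+ (b :+ d)) refl (h false 0) (h true 0) _ _

  -- `2 ^ d` times the expectation of `F` under uniform digits; unnormalised, so that the recursion
  -- stays in the natural numbers.
  digitSum : ℕ → (List Bool → ℕ) → ℕ
  digitSum zero    F = F []
  digitSum (suc d) F = digitSum d (F ∘ (false ∷_)) + digitSum d (F ∘ (true ∷_))

  partialSum-const : ∀ c N → partialSum (λ _ → c) N ≡ c * N
  partialSum-const c zero    = sym (*-zeroʳ c)
  partialSum-const c (suc N) = trans (cong (c +_) (partialSum-const c N)) (sym (*-suc c N))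

  2*⌊n/2⌋≤n : ∀ n → 2 * ⌊ n /2⌋ ≤ n
  2*⌊n/2⌋≤n zero          = z≤n
  2*⌊n/2⌋≤n (suc zero)    = z≤n
  2*⌊n/2⌋≤n (suc (suc n)) rewrite *-suc 2 ⌊ n /2⌋ = s≤s (s≤s (2*⌊n/2⌋≤n n))

  n≤1+2*⌊n/2⌋ : ∀ n → n ≤ suc (2 * ⌊ n /2⌋)
  n≤1+2*⌊n/2⌋ zero          = z≤n
  n≤1+2*⌊n/2⌋ (suc zero)    = s≤s z≤n
  n≤1+2*⌊n/2⌋ (suc (suc n)) rewrite *-suc 2 ⌊ n /2⌋ = s≤s (s≤s (n≤1+2*⌊n/2⌋ n))

  -- Equidistribution with an error independent of `N`: at each digit the even and odd indices below
  -- `N` number `N / 2` up to rounding.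
  partialSum-lowDigits : ∀ d F → ∃ λ C → ∀ N →
    let S = 2 ^ d * partialSum (F ∘ lowDigits d) N ; T = digitSum d F * N in
    S ≤ T + C × T ≤ S + C
  partialSum-lowDigits zero    F = 0 , λ N → ≤-reflexive (eq N) , ≤-reflexive (sym (eq′ N))
    where
    eq : ∀ N → 1 * partialSum (λ _ → F []) N ≡ F [] * N + 0
    eq N = trans (*-identityˡ _) (trans (partialSum-const (F []) N) (sym (+-identityʳ _)))
    eq′ : ∀ N → 1 * partialSum (λ _ → F []) N + 0 ≡ F [] * N
    eq′ N = trans (+-identityʳ _) (trans (*-identityˡ _) (partialSum-const (F []) N))
  partialSum-lowDigits (suc d) F
    with partialSum-lowDigits d (F ∘ (false ∷_)) | partialSum-lowDigits d (F ∘ (true ∷_))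
  ... | C₀ , h₀ | C₁ , h₁ = t₀ + t₁ + 2 * (C₀ + C₁) , λ N → upper N , lower N
    where
    open ≤-Reasoning
    t₀ = digitSum d (F ∘ (false ∷_))
    t₁ = digitSum d (F ∘ (true ∷_))
    S₀ S₁ : ℕ → ℕ
    S₀ = partialSum (F ∘ (false ∷_) ∘ lowDigits d)
    S₁ = partialSum (F ∘ (true ∷_) ∘ lowDigits d)
    split : ∀ N → 2 ^ suc d * partialSum (F ∘ lowDigits (suc d)) N
                ≡ 2 * (2 ^ d * S₀ ⌈ N /2⌉ + 2 ^ d * S₁ ⌊ N /2⌋)
    split N = trans (cong (2 ^ suc d *_) (partialSum-parity (λ b n → F (b ∷ lowDigits d n)) N))
      (solve 3 (λ x a b → (x :+ (x :+ con 0)) :* (a :+ b) := con 2 :* (x :* a :+ x :* b)) refl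
         (2 ^ d) (S₀ ⌈ N /2⌉) (S₁ ⌊ N /2⌋))
    upper : ∀ N → 2 ^ suc d * partialSum (F ∘ lowDigits (suc d)) N ≤ (t₀ + t₁) * N + (t₀ + t₁ + 2 * (C₀ + C₁))
    upper N = begin
      2 ^ suc d * partialSum (F ∘ lowDigits (suc d)) N
        ≡⟨ split N ⟩
      2 * (2 ^ d * S₀ ⌈ N /2⌉ + 2 ^ d * S₁ ⌊ N /2⌋)
        ≤⟨ *-monoʳ-≤ 2 (+-mono-≤ (proj₁ (h₀ ⌈ N /2⌉)) (proj₁ (h₁ ⌊ N /2⌋))) ⟩
      2 * (t₀ * ⌈ N /2⌉ + C₀ + (t₁ * ⌊ N /2⌋ + C₁))
        ≡⟨ solve 6 (λ a x c b y e → con 2 :* (a :* x :+ c :+ (b :* y :+ e))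
                     := a :* (con 2 :* x) :+ b :* (con 2 :* y) :+ con 2 :* (c :+ e)) refl t₀ ⌈ N /2⌉ C₀ t₁ ⌊ N /2⌋ C₁ ⟩
      t₀ * (2 * ⌈ N /2⌉) + t₁ * (2 * ⌊ N /2⌋) + 2 * (C₀ + C₁)
        ≤⟨ +-monoˡ-≤ (2 * (C₀ + C₁)) (+-mono-≤ (*-monoʳ-≤ t₀ (2*⌊n/2⌋≤n (suc N)))
             (*-monoʳ-≤ t₁ (≤-trans (2*⌊n/2⌋≤n N) (n≤1+n N)))) ⟩
      t₀ * suc N + t₁ * suc N + 2 * (C₀ + C₁)
        ≡⟨ solve 4 (λ a b n c → a :* (con 1 :+ n) :+ b :* (con 1 :+ n) :+ c := (a :+ b) :* n :+ (a :+ b :+ c)) refl t₀ t₁ N (2 * (C₀ + C₁)) ⟩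
      (t₀ + t₁) * N + (t₀ + t₁ + 2 * (C₀ + C₁)) ∎
    lower : ∀ N → (t₀ + t₁) * N ≤ 2 ^ suc d * partialSum (F ∘ lowDigits (suc d)) N + (t₀ + t₁ + 2 * (C₀ + C₁))
    lower N = begin
      (t₀ + t₁) * N
        ≡⟨ *-distribʳ-+ N t₀ t₁ ⟩
      t₀ * N + t₁ * N
        ≤⟨ +-mono-≤ (*-monoʳ-≤ t₀ (≤-trans (n≤1+n N) (n≤1+2*⌊n/2⌋ (suc N)))) (*-monoʳ-≤ t₁ (n≤1+2*⌊n/2⌋ N)) ⟩
      t₀ * suc (2 * ⌈ N /2⌉) + t₁ * suc (2 * ⌊ N /2⌋)
        ≡⟨ solve 4 (λ a x b y → a :* (con 1 :+ con 2 :* x) :+ b :* (con 1 :+ con 2 :* y)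
                     := con 2 :* (a :* x :+ b :* y) :+ (a :+ b)) refl t₀ ⌈ N /2⌉ t₁ ⌊ N /2⌋ ⟩
      2 * (t₀ * ⌈ N /2⌉ + t₁ * ⌊ N /2⌋) + (t₀ + t₁)
        ≤⟨ +-monoˡ-≤ (t₀ + t₁) (*-monoʳ-≤ 2 (+-mono-≤ (proj₂ (h₀ ⌈ N /2⌉)) (proj₂ (h₁ ⌊ N /2⌋)))) ⟩
      2 * (2 ^ d * S₀ ⌈ N /2⌉ + C₀ + (2 ^ d * S₁ ⌊ N /2⌋ + C₁)) + (t₀ + t₁)
        ≡⟨ solve 5 (λ a c b e t → con 2 :* (a :+ c :+ (b :+ e)) :+ t := con 2 :* (a :+ b) :+ (t :+ con 2 :* (c :+ e)))
             refl (2 ^ d * S₀ ⌈ N /2⌉) C₀ (2 ^ d * S₁ ⌊ N /2⌋) C₁ (t₀ + t₁) ⟩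
      2 * (2 ^ d * S₀ ⌈ N /2⌉ + 2 ^ d * S₁ ⌊ N /2⌋) + (t₀ + t₁ + 2 * (C₀ + C₁))
        ≡⟨ cong (_+ (t₀ + t₁ + 2 * (C₀ + C₁))) (sym (split N)) ⟩
      2 ^ suc d * partialSum (F ∘ lowDigits (suc d)) N + (t₀ + t₁ + 2 * (C₀ + C₁)) ∎

  digitSum-cong : ∀ d {F H : List Bool → ℕ} → (∀ v → F v ≡ H v) → digitSum d F ≡ digitSum d H
  digitSum-cong zero    F≡H = F≡H []
  digitSum-cong (suc d) F≡H = cong₂ _+_ (digitSum-cong d (λ v → F≡H (false ∷ v))) (digitSum-cong d (λ v → F≡H (true ∷ v)))

  -- `inLastRange` and `size` unfold only on three exposed digits; this variant exposes one more
  -- before the comparison.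
  digitSum-cong⁺ : ∀ d (F H : List Bool → ℕ) → (∀ b v → F (b ∷ v) ≡ H (b ∷ v)) → digitSum (suc d) F ≡ digitSum (suc d) H
  digitSum-cong⁺ d F H F≡H = cong₂ _+_ (digitSum-cong d (F≡H false)) (digitSum-cong d (F≡H true))

  digitSum-mono : ∀ d {F H : List Bool → ℕ} → (∀ v → F v ≤ H v) → digitSum d F ≤ digitSum d H
  digitSum-mono zero    F≤H = F≤H []
  digitSum-mono (suc d) F≤H = +-mono-≤ (digitSum-mono d (λ v → F≤H (false ∷ v))) (digitSum-mono d (λ v → F≤H (true ∷ v)))

  digitSum-+ : ∀ d (F H : List Bool → ℕ) → digitSum d (λ v → F v + H v) ≡ digitSum d F + digitSum d H
  digitSum-+ zero    F H = refl
  digitSum-+ (suc d) F H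
    rewrite digitSum-+ d (F ∘ (false ∷_)) (H ∘ (false ∷_)) | digitSum-+ d (F ∘ (true ∷_)) (H ∘ (true ∷_)) =
    solve 4 (λ a b c d → a :+ b :+ (c :+ d) := a :+ c :+ (b :+ d)) refl (digitSum d (F ∘ (false ∷_))) _ _ _

  digitSum-const : ∀ d c → digitSum d (λ _ → c) ≡ 2 ^ d * c
  digitSum-const zero    c = sym (+-identityʳ c)
  digitSum-const (suc d) c rewrite digitSum-const d c =
    solve 2 (λ x c → x :* c :+ x :* c := (x :+ (x :+ con 0)) :* c) refl (2 ^ d) c

  digitSum-zero : ∀ d → digitSum d (λ _ → 0) ≡ 0
  digitSum-zero d = trans (digitSum-const d 0) (*-zeroʳ (2 ^ d))

  digitSum-drop : ∀ d L F → digitSum (d + L) (F ∘ drop d) ≡ 2 ^ d * digitSum L F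
  digitSum-drop zero    L F = sym (+-identityʳ _)
  digitSum-drop (suc d) L F rewrite digitSum-drop d L F =
    solve 2 (λ x c → x :* c :+ x :* c := (x :+ (x :+ con 0)) :* c) refl (2 ^ d) (digitSum L F)

  digitSum-constantly : ∀ c L → digitSum L (constantly c) ≡ 1
  digitSum-constantly c     zero    = refl
  digitSum-constantly false (suc L) = cong₂ _+_ (digitSum-constantly false L) (digitSum-zero L)
  digitSum-constantly true  (suc L) = cong₂ _+_ (digitSum-zero L) (digitSum-constantly true L)

  digitSum-flat : ∀ L → digitSum L flat ≡ 2
  digitSum-flat L = trans (digitSum-+ L (constantly false) (constantly true))
    (cong₂ _+_ (digitSum-constantly false L) (digitSum-constantly true L))

  -- The recursion for the mean proof size.

  half : Bool → ℕ → ℕ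
  half false m = ⌈ m /2⌉
  half true  m = ⌊ m /2⌋

  ⌊2p+m/2⌋ : ∀ p m → ⌊ p + p + m /2⌋ ≡ p + ⌊ m /2⌋
  ⌊2p+m/2⌋ zero    m = refl
  ⌊2p+m/2⌋ (suc p) m rewrite +-suc p p = cong suc (⌊2p+m/2⌋ p m)

  -- `next b k + 1` is `k + 1` halved, rounded up for digit 0 and down for digit 1. The power
  -- `2 ^ suc p` halves exactly, so only the excess `m` is rounded.
  next-level : ∀ p k m b → suc k ≡ 2 ^ suc p + m → suc (next b k) ≡ 2 ^ p + half b m
  next-level p k m b eq = begin
    suc (next b k)              ≡⟨ next+1 b k 1≤k ⟩
    half b (suc k)              ≡⟨ cong (half b) (trans eq (cong (λ z → 2 ^ p + z + m) (+-identityʳ (2 ^ p)))) ⟩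
    half b (2 ^ p + 2 ^ p + m)  ≡⟨ half-+ b ⟩
    2 ^ p + half b m            ∎
    where
    open ≡-Reasoning
    1≤k : 1 ≤ k
    1≤k = s≤s⁻¹ (subst (2 ≤_) (sym eq) (≤-trans (^-monoʳ-≤ 2 {1} {suc p} (s≤s z≤n)) (m≤m+n _ m)))
    next+1 : ∀ b k → 1 ≤ k → suc (next b k) ≡ half b (suc k)
    next+1 false k       _ = refl
    next+1 true  (suc k) _ = refl
    half-+ : ∀ b → half b (2 ^ p + 2 ^ p + m) ≡ 2 ^ p + half b m
    half-+ false = trans (cong ⌊_/2⌋ (sym (+-suc (2 ^ p + 2 ^ p) m))) (⌊2p+m/2⌋ (2 ^ p) (suc m))
    half-+ true  = ⌊2p+m/2⌋ (2 ^ p) m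

  half-≤ : ∀ b {m} p → m ≤ 2 ^ suc p → half b m ≤ 2 ^ p
  half-≤ b {m} p m≤ = ≤-trans (half≤⌈⌉ b) (subst (⌈ m /2⌉ ≤_) (sym (n≡⌈n+n/2⌉ (2 ^ p)))
    (⌈n/2⌉-mono (subst (m ≤_) (cong (2 ^ p +_) (+-identityʳ (2 ^ p))) m≤)))
    where
    half≤⌈⌉ : ∀ b → half b m ≤ ⌈ m /2⌉
    half≤⌈⌉ false = ≤-refl
    half≤⌈⌉ true  = ⌊n/2⌋≤⌈n/2⌉ m

  -- Closed at the top, since `⌈ m /2⌉` reaches `2 ^ p` for `m = 2 ^ suc p - 1`: half-open levels
  -- would not be preserved by `next`.
  Level : ℕ → ℕ → Set
  Level p k = ∃ λ m → suc k ≡ 2 ^ p + m × m ≤ 2 ^ p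

  Level-next : ∀ p k b → Level (suc p) k → Level p (next b k)
  Level-next p k b (m , eq , m≤) = half b m , next-level p k m b eq , half-≤ b p m≤

  Level⇒nonzero : ∀ p k → Level (suc p) k → (k ≡ᵇ 0) ≡ false
  Level⇒nonzero p zero    (m , eq , _) =
    contradiction (subst (2 ≤_) (sym eq) (≤-trans (^-monoʳ-≤ 2 {1} {suc p} (s≤s z≤n)) (m≤m+n _ m))) λ { (s≤s ()) }
  Level⇒nonzero p (suc k) _ = refl

  inLastRange-step : ∀ p k b₀ b₁ b₂ v → Level (suc (suc p)) k →
    inLastRange k (b₀ ∷ b₁ ∷ b₂ ∷ v) ≡ bit (not (break b₀ b₁ b₂)) * inLastRange (next b₀ k) (b₁ ∷ b₂ ∷ v)
  inLastRange-step p k b₀ b₁ b₂ v lev rewrite Level⇒nonzero p (next b₀ k) (Level-next (suc p) k b₀ lev) = refl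

  size-step : ∀ p k b₀ b₁ b₂ v → Level (suc (suc p)) k →
    size k (b₀ ∷ b₁ ∷ b₂ ∷ v)
      ≡ suc (bit (break b₀ b₁ b₂)) + inLastRange k (b₀ ∷ b₁ ∷ b₂ ∷ v) + size (next b₀ k) (b₁ ∷ b₂ ∷ v)
  size-step p k b₀ b₁ b₂ v lev rewrite Level⇒nonzero p (next b₀ k) (Level-next (suc p) k b₀ lev) = refl

  inLastRange≤1 : ∀ k v → inLastRange k v ≤ 1
  inLastRange≤1 k []               = z≤n
  inLastRange≤1 k (b₀ ∷ [])        = z≤n
  inLastRange≤1 k (b₀ ∷ b₁ ∷ [])   = z≤n
  inLastRange≤1 k (b₀ ∷ bs@(b₁ ∷ b₂ ∷ v)) =
    if≤1 (next b₀ k ≡ᵇ 0) (break b₀ b₁ b₂) (inLastRange≤1 (next b₀ k) bs)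
    where
    if≤1 : ∀ c β {x} → x ≤ 1 → (if c then 1 else bit (not β) * x) ≤ 1
    if≤1 true  β     x≤1 = ≤-refl
    if≤1 false true  x≤1 = z≤n
    if≤1 false false x≤1 = subst (_≤ 1) (sym (+-identityʳ _)) x≤1

  -- Above a digit 0 a break occurs exactly when the next digit is 1, so the last range extends
  -- along 0s only: one branch of two survives at each level, and the base value `2 ^ 3` never
  -- grows.
  inLastRange-0 : ∀ p k → Level (suc p) k → digitSum (3 + p) (λ v → inLastRange k (false ∷ v)) ≤ 8
  inLastRange-0 zero    k lev = digitSum-mono 3 {H = λ _ → 1} (λ v → inLastRange≤1 k (false ∷ v))
  inLastRange-0 (suc p) k lev = begin
    digitSum (3 + p) (λ v → inLastRange k (false ∷ false ∷ v)) + digitSum (3 + p) (λ v → inLastRange k (false ∷ true ∷ v))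
      ≡⟨ cong₂ _+_
           (digitSum-cong⁺ (2 + p) (λ v → inLastRange k (false ∷ false ∷ v)) (λ v → inLastRange (next false k) (false ∷ v))
             (λ b v → trans (inLastRange-step p k false false b v lev) (+-identityʳ _)))
           (trans (digitSum-cong⁺ (2 + p) (λ v → inLastRange k (false ∷ true ∷ v)) (λ _ → 0)
                    (λ b v → inLastRange-step p k false true b v lev))
                  (digitSum-zero (3 + p))) ⟩
    digitSum (3 + p) (λ v → inLastRange (next false k) (false ∷ v)) + 0
      ≡⟨ +-identityʳ _ ⟩
    digitSum (3 + p) (λ v → inLastRange (next false k) (false ∷ v))
      ≤⟨ inLastRange-0 p (next false k) (Level-next (suc p) k false lev) ⟩
    8 ∎
    where open ≤-Reasoning

  -- After 11 the absence of a break forces a third 1, so again one branch of two survives; the base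
  -- value is `2 ^ 2`.
  inLastRange-11 : ∀ p k → Level (suc p) k → digitSum (2 + p) (λ v → inLastRange k (true ∷ true ∷ v)) ≤ 4
  inLastRange-11 zero    k lev = digitSum-mono 2 {H = λ _ → 1} (λ v → inLastRange≤1 k (true ∷ true ∷ v))
  inLastRange-11 (suc p) k lev = begin
    digitSum (2 + p) (λ v → inLastRange k (true ∷ true ∷ false ∷ v)) + digitSum (2 + p) (λ v → inLastRange k (true ∷ true ∷ true ∷ v))
      ≡⟨ cong₂ _+_
           (trans (digitSum-cong (2 + p) (λ v → inLastRange-step p k true true false v lev)) (digitSum-zero (2 + p)))
           (digitSum-cong (2 + p) (λ v → trans (inLastRange-step p k true true true v lev) (+-identityʳ _))) ⟩
    digitSum (2 + p) (λ v → inLastRange (next true k) (true ∷ true ∷ v))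
      ≤⟨ inLastRange-11 p (next true k) (Level-next (suc p) k true lev) ⟩
    4 ∎
    where open ≤-Reasoning

  inLastRange-10 : ∀ p k → Level (suc (suc p)) k → digitSum (3 + p) (λ v → inLastRange k (true ∷ false ∷ v)) ≤ 8
  inLastRange-10 p k lev = begin
    digitSum (3 + p) (λ v → inLastRange k (true ∷ false ∷ v))
      ≡⟨ digitSum-cong⁺ (2 + p) (λ v → inLastRange k (true ∷ false ∷ v)) (λ v → inLastRange (next true k) (false ∷ v))
           (λ b v → trans (inLastRange-step p k true false b v lev) (+-identityʳ _)) ⟩
    digitSum (3 + p) (λ v → inLastRange (next true k) (false ∷ v))
      ≤⟨ inLastRange-0 p (next true k) (Level-next (suc p) k true lev) ⟩
    8 ∎
    where open ≤-Reasoning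

  -- `8 + 8 + 4`, by the lowest digits: 0, then 10, then 11. Being independent of `p`, this
  -- contributes a term of order `1 / k` to the mean.
  digitSum-inLastRange : ∀ p k → Level (suc (suc p)) k → digitSum (5 + p) (inLastRange k) ≤ 20
  digitSum-inLastRange p k lev =
    +-mono-≤ (inLastRange-0 (suc p) k lev) (+-mono-≤ (inLastRange-10 p k lev) (inLastRange-11 (suc p) k lev))

  1+breaks : List Bool → ℕ
  1+breaks (b₀ ∷ b₁ ∷ b₂ ∷ _) = suc (bit (break b₀ b₁ b₂))
  1+breaks _                  = 0

  -- Three of the eight digit triples give a break: the source of the factor 11/8.
  digitSum-1+breaks : ∀ d → digitSum (3 + d) 1+breaks ≡ 11 * 2 ^ d
  digitSum-1+breaks d rewrite digitSum-const d 1 | digitSum-const d 2 =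
    solve 1 (λ x → ((x :* con 1 :+ x :* con 1) :+ (x :* con 2 :+ x :* con 2))
                :+ ((x :* con 1 :+ x :* con 1) :+ (x :* con 2 :+ x :* con 1)) := con 11 :* x) refl (2 ^ d)

  digitSum-size-step : ∀ p k → Level (suc (suc p)) k →
    digitSum (5 + p) (size k)
      ≡ 11 * 2 ^ (2 + p) + digitSum (5 + p) (inLastRange k)
        + (digitSum (4 + p) (size (next false k)) + digitSum (4 + p) (size (next true k)))
  digitSum-size-step p k lev = begin
    digitSum (5 + p) (size k)
      ≡⟨ cong₂ _+_ (branch false) (branch true) ⟩
    digitSum (5 + p) summand
      ≡⟨ digitSum-+ (5 + p) (λ v → 1+breaks v + inLastRange k v) rest ⟩
    digitSum (5 + p) (λ v → 1+breaks v + inLastRange k v) + digitSum (5 + p) rest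
      ≡⟨ cong (_+ digitSum (5 + p) rest) (digitSum-+ (5 + p) 1+breaks (inLastRange k)) ⟩
    digitSum (5 + p) 1+breaks + digitSum (5 + p) (inLastRange k) + digitSum (5 + p) rest
      ≡⟨ cong (λ z → z + digitSum (5 + p) (inLastRange k) + digitSum (5 + p) rest) (digitSum-1+breaks (2 + p)) ⟩
    11 * 2 ^ (2 + p) + digitSum (5 + p) (inLastRange k) + digitSum (5 + p) rest ∎
    where
    open ≡-Reasoning
    rest : List Bool → ℕ
    rest []      = 0
    rest (b ∷ v) = size (next b k) v
    summand : List Bool → ℕ
    summand v = 1+breaks v + inLastRange k v + rest v
    branch : ∀ b → digitSum (4 + p) (λ v → size k (b ∷ v))
                 ≡ digitSum (4 + p) (λ v → summand (b ∷ v))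
    branch b = cong₂ _+_ (digitSum-cong⁺ (2 + p) (λ v → size k (b ∷ false ∷ v)) (λ v → summand (b ∷ false ∷ v)) (λ b₂ v → size-step p k b false b₂ v lev))
                         (digitSum-cong⁺ (2 + p) (λ v → size k (b ∷ true ∷ v)) (λ v → summand (b ∷ true ∷ v)) (λ b₂ v → size-step p k b true b₂ v lev))

  -- p + m / 2^p interpolates log₂ (2^p + m) linearly between powers of two; this
  -- is its product with 2^p.
  logInterp : ℕ → ℕ → ℕ
  logInterp p m = p * 2 ^ p + m

  -- The offset 20 is what digitSum-inLastRange costs in each doubling step.  The
  -- induction starts at level 3 since the bound fails for k = 2, 5 and 6.
  digitSum-size-bound : ∀ p k m → suc k ≡ 2 ^ (3 + p) + m → m ≤ 2 ^ (3 + p) →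
    digitSum (6 + p) (size k) + 20 ≤ 11 * logInterp (3 + p) m + 18 * 2 ^ (3 + p)
  digitSum-size-bound zero .(7 + m) m refl m≤ = ≤-trans (≤ᵇ⇒≤ _ _ (base m m≤)) ≤-refl
    where
    base : ∀ m → m ≤ 8 → T (digitSum 6 (size (7 + m)) + 20 ≤ᵇ 11 * logInterp 3 m + 144)
    base 0 _ = tt
    base 1 _ = tt
    base 2 _ = tt
    base 3 _ = tt
    base 4 _ = tt
    base 5 _ = tt
    base 6 _ = tt
    base 7 _ = tt
    base 8 _ = tt
    base (suc (suc (suc (suc (suc (suc (suc (suc (suc m))))))))) (s≤s (s≤s (s≤s (s≤s (s≤s (s≤s (s≤s (s≤s ()))))))))
  digitSum-size-bound (suc p) k m eq m≤ = begin
    digitSum (7 + p) (size k) + 20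
      ≡⟨ cong (_+ 20) (digitSum-size-step (2 + p) k (m , eq , m≤)) ⟩
    11 * 2 ^ (4 + p) + digitSum (7 + p) (inLastRange k) + (T₀ + T₁) + 20
      ≤⟨ +-monoˡ-≤ 20 (+-monoˡ-≤ (T₀ + T₁) (+-monoʳ-≤ (11 * 2 ^ (4 + p)) (digitSum-inLastRange (2 + p) k (m , eq , m≤)))) ⟩
    11 * 2 ^ (4 + p) + 20 + (T₀ + T₁) + 20
      ≡⟨ solve 3 (λ x a b → x :+ con 20 :+ (a :+ b) :+ con 20 := x :+ ((a :+ con 20) :+ (b :+ con 20))) refl (11 * 2 ^ (4 + p)) T₀ T₁ ⟩
    11 * 2 ^ (4 + p) + ((T₀ + 20) + (T₁ + 20))
      ≤⟨ +-monoʳ-≤ (11 * 2 ^ (4 + p)) (+-mono-≤ (ih false) (ih true)) ⟩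
    11 * 2 ^ (4 + p) + ((11 * logInterp (3 + p) ⌈ m /2⌉ + 18 * P) + (11 * logInterp (3 + p) ⌊ m /2⌋ + 18 * P))
      ≡⟨ solve 4 (λ q P a b → con 11 :* (P :+ (P :+ con 0))
             :+ ((con 11 :* (q :* P :+ a) :+ con 18 :* P) :+ (con 11 :* (q :* P :+ b) :+ con 18 :* P))
           := con 11 :* ((con 1 :+ q) :* (P :+ (P :+ con 0)) :+ (b :+ a)) :+ con 18 :* (P :+ (P :+ con 0)))
           refl (3 + p) P ⌈ m /2⌉ ⌊ m /2⌋ ⟩
    11 * ((4 + p) * 2 ^ (4 + p) + (⌊ m /2⌋ + ⌈ m /2⌉)) + 18 * 2 ^ (4 + p)
      ≡⟨ cong (λ z → 11 * ((4 + p) * 2 ^ (4 + p) + z) + 18 * 2 ^ (4 + p)) (⌊n/2⌋+⌈n/2⌉≡n m) ⟩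
    11 * logInterp (4 + p) m + 18 * 2 ^ (4 + p) ∎
    where
    open ≤-Reasoning
    P = 2 ^ (3 + p)
    T₀ = digitSum (6 + p) (size (next false k))
    T₁ = digitSum (6 + p) (size (next true k))
    ih : ∀ b → digitSum (6 + p) (size (next b k)) + 20 ≤ 11 * logInterp (3 + p) (half b m) + 18 * P
    ih b = digitSum-size-bound p (next b k) (half b m) (next-level (3 + p) k m b eq) (half-≤ b (3 + p) m≤)

  -- With mean = digitSum / 2^(3+p) and Λ = logInterp p m / 2^p this reads
  -- mean ≤ 11/8 (Λ - 8/5) + 9/2 - 9/(4 (k+1)), where 8/5 > log₂ 3.
  mean-bound : ∀ p k m → 1 ≤ k → suc k ≡ 2 ^ p + m → m < 2 ^ p →
    5 * suc k * digitSum (3 + p) (size k) + 90 * 2 ^ p ≤ 55 * logInterp p m * suc k + 92 * 2 ^ p * suc k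
  mean-bound zero .0 zero () refl m<
  mean-bound zero k (suc m) 1≤k eq (s≤s ())
  -- Levels 1 and 2 contain the exceptions to `digitSum-size-bound`; the weaker bound here still
  -- holds for them, by evaluation.
  mean-bound (suc zero) .1 zero 1≤k refl m< = ≤ᵇ⇒≤ _ _ tt
  mean-bound (suc zero) .2 (suc zero) 1≤k refl m< = ≤ᵇ⇒≤ _ _ tt
  mean-bound (suc zero) k (suc (suc m)) 1≤k eq (s≤s (s≤s ()))
  mean-bound (suc (suc zero)) .3 0 1≤k refl m< = ≤ᵇ⇒≤ _ _ tt
  mean-bound (suc (suc zero)) .4 1 1≤k refl m< = ≤ᵇ⇒≤ _ _ tt
  mean-bound (suc (suc zero)) .5 2 1≤k refl m< = ≤ᵇ⇒≤ _ _ tt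
  mean-bound (suc (suc zero)) .6 3 1≤k refl m< = ≤ᵇ⇒≤ _ _ tt
  mean-bound (suc (suc zero)) k (suc (suc (suc (suc m)))) 1≤k eq (s≤s (s≤s (s≤s (s≤s ()))))
  mean-bound (suc (suc (suc p))) k m 1≤k eq m< = begin
    5 * suc k * t + 90 * P
      ≤⟨ +-monoʳ-≤ (5 * suc k * t) (*-monoʳ-≤ 90 (subst (P ≤_) (sym eq) (m≤m+n P m))) ⟩
    5 * suc k * t + 90 * suc k
      -- Two surpluses are discarded: the offset gives `5 * 20` against the required 90, and below
      -- `5 * 18` stands against `92 = 40 * 23/10`.
      ≤⟨ m≤m+n _ (10 * suc k) ⟩
    5 * suc k * t + 90 * suc k + 10 * suc k
      ≡⟨ solve 2 (λ x t → con 5 :* x :* t :+ con 90 :* x :+ con 10 :* x := con 5 :* x :* (t :+ con 20)) refl (suc k) t ⟩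
    5 * suc k * (t + 20)
      ≤⟨ *-monoʳ-≤ (5 * suc k) (digitSum-size-bound p k m eq (<⇒≤ m<)) ⟩
    5 * suc k * (11 * Λ + 18 * P)
      ≤⟨ m≤m+n _ (2 * P * suc k) ⟩
    5 * suc k * (11 * Λ + 18 * P) + 2 * P * suc k
      ≡⟨ solve 3 (λ x l P → con 5 :* x :* (con 11 :* l :+ con 18 :* P) :+ con 2 :* P :* x
                   := con 55 :* l :* x :+ con 92 :* P :* x) refl (suc k) Λ P ⟩
    55 * Λ * suc k + 92 * P * suc k ∎
    where
    open ≤-Reasoning
    P = 2 ^ (3 + p)
    Λ = logInterp (3 + p) m
    t = digitSum (6 + p) (size k)

  -- Concavity of the binary logarithm.

  ^-distribʳ-* : ∀ a b n → (a * b) ^ n ≡ a ^ n * b ^ n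
  ^-distribʳ-* a b zero    = refl
  ^-distribʳ-* a b (suc n) rewrite ^-distribʳ-* a b n =
    solve 4 (λ a b x y → a :* b :* (x :* y) := a :* x :* (b :* y)) refl a b (a ^ n) (b ^ n)

  ^-cancelˡ-≤ : ∀ n .{{_ : NonZero n}} {a b} → a ^ n ≤ b ^ n → a ≤ b
  ^-cancelˡ-≤ n a^n≤b^n = ≮⇒≥ λ b<a → <⇒≱ (^-monoˡ-< n b<a) a^n≤b^n

  -- Midpoint concavity of log₂: the step is 4 (P + a) (P + b) ≤ (2 P + a + b)².
  2^logInterp≤ : ∀ p m → m ≤ 2 ^ p → 2 ^ logInterp p m ≤ (2 ^ p + m) ^ (2 ^ p)
  2^logInterp≤ zero    zero          m≤ = ≤-refl
  2^logInterp≤ zero    (suc zero)    m≤ = ≤-refl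
  2^logInterp≤ zero    (suc (suc m)) (s≤s ())
  2^logInterp≤ (suc p) m             m≤ = begin
    2 ^ logInterp (suc p) m
      ≡⟨ cong (2 ^_) exponent ⟩
    2 ^ (2 * P + (logInterp p a + logInterp p b))
      ≡⟨ trans (^-distribˡ-+-* 2 (2 * P) _) (cong₂ _*_ (sym (^-*-assoc 2 2 P)) (^-distribˡ-+-* 2 (logInterp p a) _)) ⟩
    4 ^ P * (2 ^ logInterp p a * 2 ^ logInterp p b)
      ≤⟨ *-monoʳ-≤ (4 ^ P) (*-mono-≤ (2^logInterp≤ p a a≤) (2^logInterp≤ p b (≤-trans (⌊n/2⌋≤⌈n/2⌉ m) a≤))) ⟩
    4 ^ P * ((P + a) ^ P * (P + b) ^ P)
      ≡⟨ sym (trans (^-distribʳ-* 4 _ P) (cong (4 ^ P *_) (^-distribʳ-* (P + a) (P + b) P))) ⟩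
    (4 * ((P + a) * (P + b))) ^ P
      ≤⟨ ^-monoˡ-≤ P amgm ⟩
    ((2 ^ suc p + m) ^ 2) ^ P
      ≡⟨ ^-*-assoc (2 ^ suc p + m) 2 P ⟩
    (2 ^ suc p + m) ^ (2 ^ suc p) ∎
    where
    open ≤-Reasoning
    P = 2 ^ p
    a = ⌈ m /2⌉
    b = ⌊ m /2⌋
    -- With `a = b + δ` the two sides of `amgm` differ by exactly `δ * δ`.
    δ = a ∸ b
    a≡ : b + δ ≡ a
    a≡ = m+[n∸m]≡n (⌊n/2⌋≤⌈n/2⌉ m)
    a≤ : a ≤ P
    a≤ = subst (a ≤_) (sym (n≡⌈n+n/2⌉ P)) (⌈n/2⌉-mono (subst (m ≤_) (cong (λ z → P + z) (+-identityʳ P)) m≤))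
    exponent : logInterp (suc p) m ≡ 2 * P + (logInterp p a + logInterp p b)
    exponent = trans (cong (λ z → suc p * 2 ^ suc p + z) (sym (⌊n/2⌋+⌈n/2⌉≡n m)))
      (solve 4 (λ p P a b → (con 1 :+ p) :* (con 2 :* P) :+ (b :+ a)
                  := con 2 :* P :+ ((p :* P :+ a) :+ (p :* P :+ b))) refl p P a b)
    amgm : 4 * ((P + a) * (P + b)) ≤ (2 ^ suc p + m) ^ 2
    amgm = begin
      4 * ((P + a) * (P + b))
        ≡⟨ cong (λ z → 4 * ((P + z) * (P + b))) (sym a≡) ⟩
      4 * ((P + (b + δ)) * (P + b))
        ≤⟨ m≤m+n _ (δ * δ) ⟩
      4 * ((P + (b + δ)) * (P + b)) + δ * δ
        ≡⟨ solve 3 (λ P b d → con 4 :* ((P :+ (b :+ d)) :* (P :+ b)) :+ d :* d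
             := (con 2 :* P :+ (b :+ (b :+ d))) :* ((con 2 :* P :+ (b :+ (b :+ d))) :* con 1)) refl P b δ ⟩
      (2 * P + (b + (b + δ))) ^ 2
        ≡⟨ cong (λ z → (2 * P + z) ^ 2) (trans (cong (λ z → b + z) a≡) (⌊n/2⌋+⌈n/2⌉≡n m)) ⟩
      (2 ^ suc p + m) ^ 2 ∎

  -- From bounded errors to limiting averages.

  partialSum-shift : ∀ f s N → partialSum (f ∘ (s +_)) N ≤ partialSum f (s + N)
  partialSum-shift f s N = ≤-trans (m≤n+m _ (partialSum f s)) (≤-reflexive (sym (partialSum-+ f s N)))

  -- Integer forms of "the average of `f` is at most (at least) `u / D`", up to an error of order
  -- `1 / N`.
  Upper Lower : (ℕ → ℕ) → ℕ → ℕ → Set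
  Upper f D u = ∃ λ C → ∀ N → D * partialSum f N ≤ u * N + C
  Lower f D u = ∃ λ C → ∀ N → u * N ≤ D * partialSum f N + C

  upper-eventually : ∀ a f D u s J → (∀ j → J ≤ j → a j ≤ f (s + j)) → Upper f D u → Upper a D u
  upper-eventually a f D u s J a≤f (C , h) = u * s + C + D * partialSum a J , λ N → begin
    D * partialSum a N
      ≤⟨ *-monoʳ-≤ D (partialSum-eventually J a≤f N) ⟩
    D * (partialSum (f ∘ (s +_)) N + partialSum a J)
      ≤⟨ *-monoʳ-≤ D (+-monoˡ-≤ (partialSum a J) (partialSum-shift f s N)) ⟩
    D * (partialSum f (s + N) + partialSum a J)
      ≡⟨ *-distribˡ-+ D _ (partialSum a J) ⟩
    D * partialSum f (s + N) + D * partialSum a J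
      ≤⟨ +-monoˡ-≤ (D * partialSum a J) (h (s + N)) ⟩
    u * (s + N) + C + D * partialSum a J
      ≡⟨ solve 5 (λ u s n c t → u :* (s :+ n) :+ c :+ t := u :* n :+ (u :* s :+ c :+ t)) refl u s N C (D * partialSum a J) ⟩
    u * N + (u * s + C + D * partialSum a J) ∎
    where open ≤-Reasoning

  -- The error `e` is averaged over a denominator `x` times larger than that of `f`. Scaling by `x`
  -- keeps its share `v * N` as a separate term, which becomes negligible as `x` grows.
  lower-eventually : ∀ a f e D u x v s J → (∀ j → J ≤ j → f (s + j) ≤ a j + e (s + j)) →
    Lower f D u → Upper e (D * x) v →
    ∃ λ C → ∀ N → x * (u * N) ≤ x * (D * partialSum a N) + v * N + C
  lower-eventually a f e D u x v s J f≤a+e (C , h) (C′ , h′) = K , λ N → begin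
    x * (u * N)
      ≤⟨ *-monoʳ-≤ x (*-monoʳ-≤ u (m≤n+m N s)) ⟩
    x * (u * (s + N))
      ≤⟨ *-monoʳ-≤ x (h (s + N)) ⟩
    x * (D * partialSum f (s + N) + C)
      ≡⟨ cong (λ z → x * (D * z + C)) (partialSum-+ f s N) ⟩
    x * (D * (G₀ + partialSum fₛ N) + C)
      ≤⟨ *-monoʳ-≤ x (+-monoˡ-≤ C (*-monoʳ-≤ D (+-monoʳ-≤ G₀ (eventually N)))) ⟩
    x * (D * (G₀ + (partialSum a N + partialSum eₛ N + G₁)) + C)
      ≡⟨ solve 7 (λ x D g t e f c → x :* (D :* (g :+ (t :+ e :+ f)) :+ c)
                   := x :* (D :* t) :+ D :* x :* e :+ x :* (D :* (g :+ f) :+ c))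
           refl x D G₀ (partialSum a N) (partialSum eₛ N) G₁ C ⟩
    x * (D * partialSum a N) + D * x * partialSum eₛ N + x * (D * (G₀ + G₁) + C)
      ≤⟨ +-monoˡ-≤ _ (+-monoʳ-≤ (x * (D * partialSum a N))
           (≤-trans (*-monoʳ-≤ (D * x) (partialSum-shift e s N)) (h′ (s + N)))) ⟩
    x * (D * partialSum a N) + (v * (s + N) + C′) + x * (D * (G₀ + G₁) + C)
      ≡⟨ solve 6 (λ t y s n c z → t :+ (y :* (s :+ n) :+ c) :+ z := t :+ y :* n :+ (y :* s :+ c :+ z))
           refl (x * (D * partialSum a N)) v s N C′ (x * (D * (G₀ + G₁) + C)) ⟩
    x * (D * partialSum a N) + v * N + K ∎
    where
    open ≤-Reasoning
    fₛ eₛ : ℕ → ℕ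
    fₛ = f ∘ (s +_)
    eₛ = e ∘ (s +_)
    G₀ = partialSum f s
    G₁ = partialSum fₛ J
    K = v * s + C′ + x * (D * (G₀ + G₁) + C)
    eventually : ∀ N → partialSum fₛ N ≤ partialSum a N + partialSum eₛ N + G₁
    eventually N = subst (λ z → partialSum fₛ N ≤ z + G₁) (partialSum-add a eₛ N) (partialSum-eventually J f≤a+e N)

  -- The conclusion is `average ≤ u / D + 1 / q` with denominators cleared.
  average-upper : ∀ a D u .{{_ : NonZero D}} → Upper a D u →
    ∀ q → ∃ λ N₀ → ∀ N → N₀ ≤ N → partialSum a N * (D * q) ≤ (u * q + D) * N
  average-upper a D u (C , h) q = q * C , λ N N≥ → begin
    partialSum a N * (D * q)  ≡⟨ solve 3 (λ t D q → t :* (D :* q) := q :* (D :* t)) refl (partialSum a N) D q ⟩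
    q * (D * partialSum a N)  ≤⟨ *-monoʳ-≤ q (h N) ⟩
    q * (u * N + C)           ≡⟨ solve 4 (λ q u n c → q :* (u :* n :+ c) := u :* q :* n :+ q :* c) refl q u N C ⟩
    u * q * N + q * C         ≤⟨ +-monoʳ-≤ (u * q * N) (≤-trans N≥ (m≤n*m N D)) ⟩
    u * q * N + D * N         ≡⟨ sym (*-distribʳ-+ N (u * q) D) ⟩
    (u * q + D) * N           ∎
    where open ≤-Reasoning

  n<2^n : ∀ n → n < 2 ^ n
  n<2^n zero    = s≤s z≤n
  n<2^n (suc n) = +-mono-≤ {1} {2 ^ n} (m^n>0 2 n) (≤-trans (n<2^n n) (m≤m+n _ 0))

  average-lower : ∀ a D u .{{_ : NonZero D}} →
    (∀ L → ∃ λ C → ∀ N → 2 ^ L * (u * N) ≤ 2 ^ L * (D * partialSum a N) + D * 2 * N + C) →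
    ∀ q → ∃ λ N₀ → ∀ N → N₀ ≤ N → u * (N * q) ≤ (partialSum a N * q + N) * D
  -- `2 ^ L` must dominate `2 * q + 1`: the part `2 * q` pays for the exceptional density
  -- `2 / 2 ^ L`, and 1 for the constant `C` once `N ≥ q * C`. The choice `L = 2 * q + 1` suffices.
  average-lower a D u lower q with lower (2 * q + 1)
  ... | C , h = q * C , λ N N≥ → *-cancelˡ-≤ (2 ^ (2 * q + 1)) {{m^n≢0 2 (2 * q + 1)}}
      (scaled (2 ^ (2 * q + 1)) (<⇒≤ (n<2^n (2 * q + 1))) N N≥ (h N))
    where
    open ≤-Reasoning
    scaled : ∀ x → 2 * q + 1 ≤ x → ∀ N → q * C ≤ N →
      x * (u * N) ≤ x * (D * partialSum a N) + D * 2 * N + C →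
      x * (u * (N * q)) ≤ x * ((partialSum a N * q + N) * D)
    scaled x x≥ N N≥ h = begin
      x * (u * (N * q))
        ≡⟨ solve 4 (λ x u n q → x :* (u :* (n :* q)) := q :* (x :* (u :* n))) refl x u N q ⟩
      q * (x * (u * N))
        ≤⟨ *-monoʳ-≤ q h ⟩
      q * (x * (D * t) + D * 2 * N + C)
        ≡⟨ solve 6 (λ q x D t n c → q :* (x :* (D :* t) :+ D :* con 2 :* n :+ c)
                     := x :* (D :* (t :* q)) :+ (D :* (con 2 :* q :* n) :+ q :* c)) refl q x D t N C ⟩
      x * (D * (t * q)) + (D * (2 * q * N) + q * C)
        ≤⟨ +-monoʳ-≤ (x * (D * (t * q))) (+-monoʳ-≤ (D * (2 * q * N)) (≤-trans N≥ (m≤n*m N D))) ⟩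
      x * (D * (t * q)) + (D * (2 * q * N) + D * N)
        ≡⟨ cong (x * (D * (t * q)) +_) (solve 3 (λ D q n → D :* (con 2 :* q :* n) :+ D :* n := (con 2 :* q :+ con 1) :* (D :* n)) refl D q N) ⟩
      x * (D * (t * q)) + (2 * q + 1) * (D * N)
        ≤⟨ +-monoʳ-≤ (x * (D * (t * q))) (*-monoˡ-≤ (D * N) x≥) ⟩
      x * (D * (t * q)) + x * (D * N)
        ≡⟨ solve 5 (λ x D t q n → x :* (D :* (t :* q)) :+ x :* (D :* n) := x :* ((t :* q :+ n) :* D)) refl x D t q N ⟩
      x * ((t * q + N) * D) ∎
      where t = partialSum a N

  2^≤1+k+j : ∀ x k j → 2 ^ x ≤ j → 2 ^ x ≤ suc (k + j)
  2^≤1+k+j x k j h = ≤-trans h (≤-trans (m≤n+m j k) (n≤1+n _))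

  upper-lowDigits : ∀ d F → Upper (F ∘ lowDigits d) (2 ^ d) (digitSum d F)
  upper-lowDigits d F with partialSum-lowDigits d F
  ... | C , h = C , λ N → proj₁ (h N)

  lower-lowDigits : ∀ d F → Lower (F ∘ lowDigits d) (2 ^ d) (digitSum d F)
  lower-lowDigits d F with partialSum-lowDigits d F
  ... | C , h = C , λ N → proj₂ (h N)

  σ-upper : ∀ l κ → suc κ < 2 ^ l →
    Upper (λ j → σ (suc κ) (suc κ + j)) (2 ^ (2 + l)) (digitSum (2 + l) (size (suc κ)))
  σ-upper l κ κ< =
    upper-eventually (λ j → σ (suc κ) (suc κ + j)) (size (suc κ) ∘ lowDigits (2 + l)) (2 ^ (2 + l)) (digitSum (2 + l) (size (suc κ)))
    -- The digits are those of `n + 1 = k + 1 + j`, hence the shift `2 + κ`.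
    (2 + κ) (2 ^ (2 + l + 0))
    (λ j J≤j → proj₁ (σ≈size l 0 κ (suc κ + j) κ< (2^≤1+k+j (2 + l + 0) (suc κ) j J≤j)))
    (upper-lowDigits (2 + l) (size (suc κ)))

  σ-lower : ∀ l κ → suc κ < 2 ^ l → ∀ L → ∃ λ C → ∀ N →
    2 ^ L * (digitSum (2 + l) (size (suc κ)) * N)
      ≤ 2 ^ L * (2 ^ (2 + l) * partialSum (λ j → σ (suc κ) (suc κ + j)) N) + 2 ^ (2 + l) * 2 * N + C
  σ-lower l κ κ< L =
    lower-eventually (λ j → σ (suc κ) (suc κ + j)) (size (suc κ) ∘ lowDigits (2 + l)) (flat ∘ drop (2 + l) ∘ lowDigits (2 + l + L))
    (2 ^ (2 + l)) (digitSum (2 + l) (size (suc κ))) (2 ^ L) (2 ^ (2 + l) * 2) (2 + κ) (2 ^ (2 + l + L))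
    (λ j J≤j → proj₂ (σ≈size l L κ (suc κ + j) κ< (2^≤1+k+j (2 + l + L) (suc κ) j J≤j)))
    (lower-lowDigits (2 + l) (size (suc κ)))
    (subst₂ (Upper (flat ∘ drop (2 + l) ∘ lowDigits (2 + l + L)))
      (^-distribˡ-+-* 2 (2 + l) L)
      (trans (digitSum-drop (2 + l) L flat) (cong (2 ^ (2 + l) *_) (digitSum-flat L)))
      (upper-lowDigits (2 + l + L) (flat ∘ drop (2 + l))))

  binary-decomposition : ∀ n → 1 ≤ n → ∃₂ λ p m → n ≡ 2 ^ p + m × m < 2 ^ p
  binary-decomposition (suc zero)    _ = 0 , 0 , refl , s≤s z≤n
  binary-decomposition (suc (suc n)) _ with binary-decomposition (suc n) (s≤s z≤n)
  ... | p , m , eq , m< with m≤n⇒m<n∨m≡n m<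
  ...   | inj₁ m<′ = p , suc m , trans (cong suc eq) (sym (+-suc (2 ^ p) m)) , m<′
  ...   | inj₂ m≡ = suc p , 0 , trans (cong suc eq) (trans (sym (+-suc (2 ^ p) m))
            (trans (cong (2 ^ p +_) (trans m≡ (sym (+-identityʳ (2 ^ p))))) (sym (+-identityʳ _)))) , m^n>0 2 (suc p)

-- Comparing rationals with logarithms of fractions.

module Logarithm where

  open import Data.Integer using (+_; -[1+_])
  import Data.Integer as ℤ
  import Data.Integer.Properties as ℤ
  open import Data.Integer.GCD using (gcd)
  open import Data.Nat hiding (_/_)
  open import Data.Nat.Properties
  open import Data.Nat.Solver using (module +-*-Solver)
  open import Data.Product using (∃; _×_; _,_)
  open import Data.Rational using (_/_; ↥_; ↧ₙ_; ↧_)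
  import Data.Rational.Properties as ℚ
  open import Relation.Binary.PropositionalEquality
  open +-*-Solver using (solve; _:+_; _:*_; _:=_; con)

  open Digits using (^-distribʳ-*; ^-cancelˡ-≤)

  -- Here A and B over Q stand for the exponent (A - B) / Q.
  ≤log₂-intro : ∀ y r A B Q .{{_ : NonZero Q}} →
    posPart (↥ y) * Q + B * ↧ₙ y ≤ A * ↧ₙ y + negPart (↥ y) * Q →
    2 ^ A * (↧ₙ r) ^ Q ≤ 2 ^ B * ℤ.∣ ↥ r ∣ ^ Q →
    y ≤log₂ r
  -- Both exponents are brought to the common denominator `q * Q`: the goal is raised to the power
  -- `Q`, the hypothesis on `r` to the power `q`. The factor `2 ^ (B * q)` replaces a negative
  -- exponent.
  ≤log₂-intro y r A B Q y≤ r≥ = ^-cancelˡ-≤ Q (*-cancelˡ-≤ (2 ^ (B * q)) {{m^n≢0 2 (B * q)}} (begin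
    2 ^ (B * q) * (2 ^ a * v ^ q) ^ Q
      ≡⟨ cong (2 ^ (B * q) *_) (power a v) ⟩
    2 ^ (B * q) * (2 ^ (a * Q) * v ^ (q * Q))
      ≡⟨ trans (sym (*-assoc (2 ^ (B * q)) _ _)) (cong (_* v ^ (q * Q)) (sym (trans (cong (2 ^_) (+-comm (a * Q) (B * q))) (^-distribˡ-+-* 2 (B * q) (a * Q))))) ⟩
    2 ^ (a * Q + B * q) * v ^ (q * Q)
      ≤⟨ *-monoˡ-≤ (v ^ (q * Q)) (^-monoʳ-≤ 2 y≤) ⟩
    2 ^ (A * q + b * Q) * v ^ (q * Q)
      ≡⟨ trans (cong₂ _*_ (^-distribˡ-+-* 2 (A * q) (b * Q)) (cong (v ^_) (*-comm q Q)))
               (solve 3 (λ x y z → x :* y :* z := y :* (x :* z)) refl (2 ^ (A * q)) (2 ^ (b * Q)) (v ^ (Q * q))) ⟩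
    2 ^ (b * Q) * (2 ^ (A * q) * v ^ (Q * q))
      ≤⟨ *-monoʳ-≤ (2 ^ (b * Q)) (subst₂ _≤_ (power′ A v) (power′ B u) (^-monoˡ-≤ q r≥)) ⟩
    2 ^ (b * Q) * (2 ^ (B * q) * u ^ (Q * q))
      ≡⟨ trans (cong (λ z → 2 ^ (b * Q) * (2 ^ (B * q) * u ^ z)) (*-comm Q q))
               (solve 3 (λ x y z → x :* (y :* z) := y :* (x :* z)) refl (2 ^ (b * Q)) (2 ^ (B * q)) (u ^ (q * Q))) ⟩
    2 ^ (B * q) * (2 ^ (b * Q) * u ^ (q * Q))
      ≡⟨ cong (2 ^ (B * q) *_) (sym (power b u)) ⟩
    2 ^ (B * q) * (2 ^ b * u ^ q) ^ Q ∎))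
    where
    open ≤-Reasoning
    q = ↧ₙ y
    a = posPart (↥ y)
    b = negPart (↥ y)
    u = ℤ.∣ ↥ r ∣
    v = ↧ₙ r
    power : ∀ c w → (2 ^ c * w ^ q) ^ Q ≡ 2 ^ (c * Q) * w ^ (q * Q)
    power c w = trans (^-distribʳ-* (2 ^ c) (w ^ q) Q) (cong₂ _*_ (^-*-assoc 2 c Q) (^-*-assoc w q Q))
    power′ : ∀ c w → (2 ^ c * w ^ Q) ^ q ≡ 2 ^ (c * q) * w ^ (Q * q)
    power′ c w = trans (^-distribʳ-* (2 ^ c) (w ^ Q) q) (cong₂ _*_ (^-*-assoc 2 c q) (^-*-assoc w Q q))

  -- `_≤log₂_` reads the numerator and denominator in lowest terms; `g` is the common factor removed
  -- by `_/_`.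
  reduce-fraction : ∀ n d .{{_ : NonZero n}} .{{_ : NonZero d}} → ∃ λ g →
    NonZero g × ℤ.∣ ↥ (+ n / d) ∣ * g ≡ n × ↧ₙ (+ n / d) * g ≡ d
  reduce-fraction n@(suc _) d@(suc _) = g , nz , num , den
    where
    g = ℤ.∣ gcd (+ n) (+ d) ∣
    r = + n / d
    num : ℤ.∣ ↥ r ∣ * g ≡ n
    num = trans (sym (ℤ.abs-* (↥ r) (gcd (+ n) (+ d)))) (cong ℤ.∣_∣ (ℚ.↥-/ (+ n) d))
    den : ↧ₙ r * g ≡ d
    den = trans (sym (ℤ.abs-* (↧ r) (gcd (+ n) (+ d)))) (cong ℤ.∣_∣ (ℚ.↧-/ (+ n) d))
    nz : NonZero g
    nz = ≢-nonZero λ g≡0 → 0≢1+n (trans (sym (*-zeroʳ (↧ₙ r))) (trans (cong (↧ₙ r *_) (sym g≡0)) den))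

  ≤log₂-fraction : ∀ y n d A B Q .{{_ : NonZero n}} .{{_ : NonZero d}} .{{_ : NonZero Q}} →
    posPart (↥ y) * Q + B * ↧ₙ y ≤ A * ↧ₙ y + negPart (↥ y) * Q →
    2 ^ A * d ^ Q ≤ 2 ^ B * n ^ Q →
    y ≤log₂ (+ n / d)
  ≤log₂-fraction y n d A B Q y≤ r≥ with reduce-fraction n d
  ... | g , nz , num , den = ≤log₂-intro y (+ n / d) A B Q y≤
    (*-cancelʳ-≤ _ _ (g ^ Q) {{m^n≢0 g Q {{nz}}}} (subst₂ _≤_ (regroup A den) (regroup B num) r≥))
    where
    regroup : ∀ c {w z} → w * g ≡ z → 2 ^ c * z ^ Q ≡ 2 ^ c * w ^ Q * g ^ Q
    regroup c {w} refl = trans (cong (2 ^ c *_) (^-distribʳ-* w g Q)) (sym (*-assoc (2 ^ c) _ _))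

  posPart-negPart : ∀ i → i ≡ + posPart i ℤ.- + negPart i
  posPart-negPart (+ n)      = sym (ℤ.+-identityʳ (+ n))
  posPart-negPart (-[1+ n ]) = refl

-- Rational forms of the integer estimates.

open import Data.Nat using (ℕ; suc; _*_; _≥_)
open import Data.Integer using (+_)
open import Data.Product using (Σ; _×_)
open import Data.Rational using (ℚ; _/_; _+_; _-_; _≤_; _<_; ∣_∣; 0ℚ)
import Data.Rational as ℚ

import Data.Integer as ℤ
import Data.Integer.Properties as ℤ
import Data.Integer.Solver as ℤ
open import Data.Nat using (NonZero; s≤s; z≤n; _^_)
import Data.Nat as ℕ
import Data.Nat.Properties as ℕ
import Data.Nat.Solver as ℕ
open import Data.Product using (∃; _,_; proj₁; proj₂)
open import Data.Rational using (mkℚ; ↥_; ↧ₙ_; toℚᵘ; *<*)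
import Data.Rational.Properties as ℚ
import Data.Rational.Solver as ℚ
open import Data.Rational.Unnormalised using (mkℚᵘ; *≤*)
import Data.Rational.Unnormalised as ℚᵘ
import Data.Rational.Unnormalised.Properties as ℚᵘ
open import Data.Sum using (inj₁; inj₂)
open import Relation.Binary.PropositionalEquality

open Digits
open Logarithm

-- The only cross-multiplication of sums; a single fraction is compared by taking `+ 0 / 1` as its
-- partner.
fraction-+-≤ : ∀ a n b m c o d r .{{_ : NonZero n}} .{{_ : NonZero m}} .{{_ : NonZero o}} .{{_ : NonZero r}} →
  (a * m ℕ.+ b * n) * (o * r) ℕ.≤ (c * r ℕ.+ d * o) * (n * m) →
  + a / n + + b / m ≤ + c / o + + d / r
fraction-+-≤ a n@(suc n′) b m@(suc m′) c o@(suc o′) d r@(suc r′) h = ℚ.toℚᵘ-cancel-≤ (begin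
  toℚᵘ (+ a / n + + b / m)                   ≃⟨ sum≃ a n′ b m′ ⟩
  mkℚᵘ (+ a) n′ ℚᵘ.+ mkℚᵘ (+ b) m′           ≤⟨ *≤* (subst₂ ℤ._≤_ (cross a n b m (o * r)) (cross c o d r (n * m)) (ℤ.+≤+ h)) ⟩
  mkℚᵘ (+ c) o′ ℚᵘ.+ mkℚᵘ (+ d) r′           ≃⟨ sum≃ c o′ d r′ ⟨
  toℚᵘ (+ c / o + + d / r)                   ∎)
  where
  open ℚᵘ.≤-Reasoning
  sum≃ : ∀ a n b m → toℚᵘ (+ a / suc n + + b / suc m) ℚᵘ.≃ mkℚᵘ (+ a) n ℚᵘ.+ mkℚᵘ (+ b) m
  sum≃ a n b m = ℚᵘ.≃-trans (ℚ.toℚᵘ-homo-+ (+ a / suc n) (+ b / suc m))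
    (ℚᵘ.+-cong (ℚ.toℚᵘ-fromℚᵘ (mkℚᵘ (+ a) n)) (ℚ.toℚᵘ-fromℚᵘ (mkℚᵘ (+ b) m)))
  cross : ∀ a n b m x → + ((a * m ℕ.+ b * n) * x) ≡ (+ a ℤ.* + m ℤ.+ + b ℤ.* + n) ℤ.* + x
  cross a n b m x = trans (ℤ.pos-* (a * m ℕ.+ b * n) x) (cong (ℤ._* + x)
    (trans (ℤ.pos-+ (a * m) (b * n)) (cong₂ ℤ._+_ (ℤ.pos-* a m) (ℤ.pos-* b n))))

fraction-* : ∀ a n b m .{{_ : NonZero n}} .{{_ : NonZero m}} .{{_ : NonZero (n * m)}} →
  (+ a / n) ℚ.* (+ b / m) ≡ + (a * b) / (n * m)
fraction-* a n@(suc n′) b m@(suc m′) = ℚ.toℚᵘ-injective (begin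
  toℚᵘ ((+ a / n) ℚ.* (+ b / m))           ≈⟨ ℚ.toℚᵘ-homo-* (+ a / n) (+ b / m) ⟩
  toℚᵘ (+ a / n) ℚᵘ.* toℚᵘ (+ b / m)       ≈⟨ ℚᵘ.*-cong (ℚ.toℚᵘ-fromℚᵘ (mkℚᵘ (+ a) n′)) (ℚ.toℚᵘ-fromℚᵘ (mkℚᵘ (+ b) m′)) ⟩
  mkℚᵘ (+ a) n′ ℚᵘ.* mkℚᵘ (+ b) m′         ≡⟨ cong (λ z → mkℚᵘ z (ℕ.pred (n * m))) (sym (ℤ.pos-* a b)) ⟩
  mkℚᵘ (+ (a * b)) (ℕ.pred (n * m))         ≈⟨ ℚᵘ.≃-sym (ℚ.toℚᵘ-fromℚᵘ (mkℚᵘ (+ (a * b)) (ℕ.pred (n * m)))) ⟩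
  toℚᵘ (+ (a * b) / (n * m))                ∎)
  where open import Relation.Binary.Reasoning.Setoid ℚᵘ.≃-setoid

open ℚ.+-*-Solver using (_:-_) renaming (solve to solveℚ; _:+_ to _⊕_; _:*_ to _⊗_; _:=_ to _⊜_; con to conℚ)
open ℕ.+-*-Solver using (solve; _:+_; _:*_; _:=_; con)

unit-fraction-below : ∀ ε → 0ℚ < ε → ∃ λ q → + 1 / suc q ≤ ε
unit-fraction-below (mkℚ (+ 0) d _) (*<* (ℤ.+<+ ()))
-- A positive numerator is at least 1, so the denominator of `ε` itself serves.
unit-fraction-below ε@(mkℚ (+ suc n) d _) _ = d ,
  subst₂ _≤_ (ℚ.+-identityʳ (+ 1 / suc d)) (trans (ℚ.+-identityʳ (+ suc n / suc d)) (ℚ.↥p/↧p≡p ε))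
    (fraction-+-≤ 1 (suc d) 0 1 (suc n) (suc d) 0 1
      (subst₂ ℕ._≤_
        (solve 1 (λ s → s := con 1 :* (s :* con 1)) refl (suc d))
        (solve 2 (λ n s → s :* (con 1 :+ n) := ((con 1 :+ n) :* con 1 :+ con 0 :* s) :* (s :* con 1)) refl n (suc d))
        (ℕ.m≤m*n (suc d) (suc n))))
unit-fraction-below (mkℚ ℤ.-[1+ n ] d _) (*<* ())

∣-∣≤ : ∀ {x y ε} → x ≤ y + ε → y ≤ x + ε → ∣ x - y ∣ ≤ ε
∣-∣≤ {x} {y} {ε} x≤ y≤ with ℚ.∣p∣≡p∨∣p∣≡-p (x - y)
... | inj₁ eq = subst₂ _≤_ (sym eq) (solveℚ 2 (λ y e → y ⊕ e :- y ⊜ e) refl y ε) (ℚ.+-monoˡ-≤ (ℚ.- y) x≤)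
... | inj₂ eq = subst₂ _≤_ (trans (solveℚ 2 (λ x y → y :- x ⊜ conℚ 0ℚ :- (x :- y)) refl x y) (trans (ℚ.+-identityˡ _) (sym eq)))
                  (solveℚ 2 (λ x e → x ⊕ e :- x ⊜ e) refl x ε) (ℚ.+-monoˡ-≤ (ℚ.- x) y≤)

-- Supplies the exponent premise of `≤log₂-fraction` for the intermediate value `Λ / P - 8/5`, that
-- is `A = 5 Λ`, `B = 8 P`, `Q = 5 P`. The negative part of `y` is added to both sides to stay in
-- the naturals.
clear-denominators : ∀ y Λ P .{{_ : NonZero P}} → y + + 8 / 5 ≤ + Λ / P →
  posPart (↥ y) * (5 * P) ℕ.+ 8 * P * ↧ₙ y ℕ.≤ 5 * Λ * ↧ₙ y ℕ.+ negPart (↥ y) * (5 * P)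
clear-denominators y@(mkℚ _ _ _) Λ P@(suc P′) h = ℤ.drop‿+≤+ (subst₂ ℤ._≤_ lhs rhs (ℤ.+-monoˡ-≤ (+ (b * (5 * P))) crossed))
  where
  a = posPart (↥ y)
  b = negPart (↥ y)
  q = ↧ₙ y
  crossed : (↥ y ℤ.* + 5 ℤ.+ + 8 ℤ.* + q) ℤ.* + P ℤ.≤ + Λ ℤ.* + (q * 5)
  crossed = ℚᵘ.drop-*≤* (ℚᵘ.≤-respˡ-≃ (ℚ.toℚᵘ-homo-+ y (+ 8 / 5))
    (ℚᵘ.≤-respʳ-≃ (ℚ.toℚᵘ-fromℚᵘ (mkℚᵘ (+ Λ) P′)) (ℚ.toℚᵘ-mono-≤ h)))
  open ℤ.+-*-Solver using () renaming (solve to solveℤ; _:+_ to _⊞_; _:*_ to _⊠_; _:-_ to _⊟_; _:=_ to _≐_; con to conℤ)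
  lhs : (↥ y ℤ.* + 5 ℤ.+ + 8 ℤ.* + q) ℤ.* + P ℤ.+ + (b * (5 * P)) ≡ + (a * (5 * P) ℕ.+ 8 * P * q)
  lhs = begin
    (↥ y ℤ.* + 5 ℤ.+ + 8 ℤ.* + q) ℤ.* + P ℤ.+ + (b * (5 * P))
      ≡⟨ cong₂ (λ i j → (i ℤ.* + 5 ℤ.+ + 8 ℤ.* + q) ℤ.* + P ℤ.+ j) (posPart-negPart (↥ y)) (pos-*-5* b) ⟩
    ((+ a ℤ.- + b) ℤ.* + 5 ℤ.+ + 8 ℤ.* + q) ℤ.* + P ℤ.+ + b ℤ.* (+ 5 ℤ.* + P)
      ≡⟨ solveℤ 4 (λ a b q P → ((a ⊟ b) ⊠ conℤ (+ 5) ⊞ conℤ (+ 8) ⊠ q) ⊠ P ⊞ b ⊠ (conℤ (+ 5) ⊠ P)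
           ≐ a ⊠ (conℤ (+ 5) ⊠ P) ⊞ conℤ (+ 8) ⊠ P ⊠ q) refl (+ a) (+ b) (+ q) (+ P) ⟩
    + a ℤ.* (+ 5 ℤ.* + P) ℤ.+ + 8 ℤ.* + P ℤ.* + q
      ≡⟨ cong₂ ℤ._+_ (sym (pos-*-5* a)) (sym (trans (ℤ.pos-* (8 * P) q) (cong (ℤ._* + q) (ℤ.pos-* 8 P)))) ⟩
    + (a * (5 * P)) ℤ.+ + (8 * P * q)
      ≡⟨ sym (ℤ.pos-+ (a * (5 * P)) (8 * P * q)) ⟩
    + (a * (5 * P) ℕ.+ 8 * P * q) ∎
    where
    open ≡-Reasoning
    pos-*-5* : ∀ c → + (c * (5 * P)) ≡ + c ℤ.* (+ 5 ℤ.* + P)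
    pos-*-5* c = trans (ℤ.pos-* c (5 * P)) (cong (+ c ℤ.*_) (ℤ.pos-* 5 P))
  rhs : + Λ ℤ.* + (q * 5) ℤ.+ + (b * (5 * P)) ≡ + (5 * Λ * q ℕ.+ b * (5 * P))
  rhs = trans (cong (ℤ._+ + (b * (5 * P))) (sym (ℤ.pos-* Λ (q * 5))))
    (trans (sym (ℤ.pos-+ (Λ * (q * 5)) (b * (5 * P))))
      (cong (λ z → + (z ℕ.+ b * (5 * P))) (solve 2 (λ l q → l :* (q :* con 5) := con 5 :* l :* q) refl Λ q)))

-- Integer form of `Λ / P - 8/5 ≤ log₂ ((P + m) / 3)`. The estimate for 3 is
-- `3 ^ 5 = 243 ≤ 256 = 2 ^ 8`.
3-logInterp : ∀ p m → m ℕ.≤ 2 ^ p →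
  2 ^ (5 * logInterp p m) * 3 ^ (5 * 2 ^ p) ℕ.≤ 2 ^ (8 * 2 ^ p) * (2 ^ p ℕ.+ m) ^ (5 * 2 ^ p)
3-logInterp p m m≤ = begin
  2 ^ (5 * Λ) * 3 ^ (5 * P)          ≡⟨ cong₂ _*_ (trans (cong (2 ^_) (ℕ.*-comm 5 Λ)) (sym (ℕ.^-*-assoc 2 Λ 5))) (sym (ℕ.^-*-assoc 3 5 P)) ⟩
  (2 ^ Λ) ^ 5 * (3 ^ 5) ^ P          ≤⟨ ℕ.*-mono-≤ (ℕ.^-monoˡ-≤ 5 (2^logInterp≤ p m m≤)) (ℕ.^-monoˡ-≤ P (ℕ.≤ᵇ⇒≤ (3 ^ 5) (2 ^ 8) _)) ⟩
  (x ^ P) ^ 5 * (2 ^ 8) ^ P          ≡⟨ cong₂ _*_ (trans (ℕ.^-*-assoc x P 5) (cong (x ^_) (ℕ.*-comm P 5))) (ℕ.^-*-assoc 2 8 P) ⟩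
  x ^ (5 * P) * 2 ^ (8 * P)          ≡⟨ ℕ.*-comm (x ^ (5 * P)) _ ⟩
  2 ^ (8 * P) * x ^ (5 * P)          ∎
  where
  open ℕ.≤-Reasoning
  P = 2 ^ p
  Λ = logInterp p m
  x = P ℕ.+ m

limits⇒cauchy : ∀ (A : ℕ → ℚ) w →
  (∀ ε → 0ℚ < ε → ∃ λ M₀ → ∀ M → M ≥ M₀ → A M ≤ w + ε) →
  (∀ ε → 0ℚ < ε → ∃ λ M₀ → ∀ M → M ≥ M₀ → w ≤ A M + ε) →
  ∀ ε → 0ℚ < ε → Σ ℕ λ M₀ → ∀ M M′ → M ≥ M₀ → M′ ≥ M₀ → ∣ A M - A M′ ∣ ≤ ε
limits⇒cauchy A w upper lower ε ε>0 =
  M₁ ℕ.⊔ M₂ , λ M M′ M≥ M′≥ → ∣-∣≤ (close M M′ M≥ M′≥) (close M′ M M′≥ M≥)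
  where
  δ = ℚ.½ ℚ.* ε
  δ>0 : 0ℚ < δ
  δ>0 = subst (_< δ) (ℚ.*-zeroʳ ℚ.½) (ℚ.*-monoʳ-<-pos ℚ.½ ε>0)
  M₁ = proj₁ (upper δ δ>0)
  M₂ = proj₁ (lower δ δ>0)
  close : ∀ M M′ → M ≥ M₁ ℕ.⊔ M₂ → M′ ≥ M₁ ℕ.⊔ M₂ → A M ≤ A M′ + ε
  close M M′ M≥ M′≥ = begin
    A M              ≤⟨ proj₂ (upper δ δ>0) M (ℕ.≤-trans (ℕ.m≤m⊔n M₁ M₂) M≥) ⟩
    w + δ            ≤⟨ ℚ.+-monoˡ-≤ δ (proj₂ (lower δ δ>0) M′ (ℕ.≤-trans (ℕ.m≤n⊔m M₁ M₂) M′≥)) ⟩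
    A M′ + δ + δ     ≡⟨ solveℚ 2 (λ a e → a ⊕ conℚ ℚ.½ ⊗ e ⊕ conℚ ℚ.½ ⊗ e ⊜ a ⊕ e) refl (A M′) ε ⟩
    A M′ + ε         ∎
    where open ℚ.≤-Reasoning

averages-upper : ∀ (total : ℕ → ℕ) mean D .{{_ : NonZero D}} →
  (∀ q → ∃ λ N₀ → ∀ N → N₀ ℕ.≤ N → total N * (D * q) ℕ.≤ (mean * q ℕ.+ D) * N) →
  ∀ ε → 0ℚ < ε → ∃ λ M₀ → ∀ M → M ≥ M₀ → + total (suc M) / suc M ≤ + mean / D + ε
averages-upper total mean D h ε ε>0 = proj₁ (h (suc q)) , λ M M≥ → ℚ.≤-trans
  (subst (_≤ + mean / D + + 1 / suc q) (ℚ.+-identityʳ _)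
    (fraction-+-≤ (total (suc M)) (suc M) 0 1 mean D 1 (suc q)
      (subst₂ ℕ._≤_
        (solve 3 (λ t n y → t :* y := (t :* con 1 :+ con 0 :* n) :* y) refl (total (suc M)) (suc M) (D * suc q))
        (solve 3 (λ u D n → (u :+ D) :* n := (u :+ con 1 :* D) :* (n :* con 1)) refl (mean * suc q) D (suc M))
        (proj₂ (h (suc q)) (suc M) (ℕ.m≤n⇒m≤1+n M≥)))))
  (ℚ.+-monoʳ-≤ (+ mean / D) (proj₂ (unit-fraction-below ε ε>0)))
  where q = proj₁ (unit-fraction-below ε ε>0)

averages-lower : ∀ (total : ℕ → ℕ) mean D .{{_ : NonZero D}} →
  (∀ q → ∃ λ N₀ → ∀ N → N₀ ℕ.≤ N → mean * (N * q) ℕ.≤ (total N * q ℕ.+ N) * D) →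
  ∀ ε → 0ℚ < ε → ∃ λ M₀ → ∀ M → M ≥ M₀ → + mean / D ≤ + total (suc M) / suc M + ε
averages-lower total mean D h ε ε>0 = proj₁ (h (suc q)) , λ M M≥ → ℚ.≤-trans
  (subst (_≤ + total (suc M) / suc M + + 1 / suc q) (ℚ.+-identityʳ _)
    (fraction-+-≤ mean D 0 1 (total (suc M)) (suc M) 1 (suc q)
      (subst₂ ℕ._≤_
        (solve 3 (λ u D y → u :* y := (u :* con 1 :+ con 0 :* D) :* y) refl mean D (suc M * suc q))
        (solve 3 (λ t n D → (t :+ n) :* D := (t :+ con 1 :* n) :* (D :* con 1)) refl (total (suc M) * suc q) (suc M) D)
        (proj₂ (h (suc q)) (suc M) (ℕ.m≤n⇒m≤1+n M≥)))))
  (ℚ.+-monoʳ-≤ (+ total (suc M) / suc M) (proj₂ (unit-fraction-below ε ε>0)))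
  where q = proj₁ (unit-fraction-below ε ε>0)

-- `23 / 10 = 9/2 - 11/8 * 8/5` is the constant left after replacing `log₂ 3` by `8/5`.
mean-fraction-bound : ∀ mean x P D Λ .{{_ : NonZero D}} .{{_ : NonZero (4 * x)}} → D ≡ 8 * P →
  5 * x * mean ℕ.+ 90 * P ℕ.≤ 55 * Λ * x ℕ.+ 92 * P * x →
  + mean / D + + 9 / (4 * x) ≤ + (11 * Λ) / D + + 23 / 10
mean-fraction-bound mean x P D Λ refl h = fraction-+-≤ mean D 9 (4 * x) (11 * Λ) D 23 10 (subst₂ ℕ._≤_
  (solve 3 (λ u x P → con 8 :* (con 8 :* P) :* (con 5 :* x :* u :+ con 90 :* P)
     := (u :* (con 4 :* x) :+ con 9 :* (con 8 :* P)) :* (con 8 :* P :* con 10)) refl mean x P)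
  (solve 3 (λ l x P → con 8 :* (con 8 :* P) :* (con 55 :* l :* x :+ con 92 :* P :* x)
     := (con 11 :* l :* con 10 :+ con 23 :* (con 8 :* P)) :* (con 8 :* P :* (con 4 :* x))) refl Λ x P)
  (ℕ.*-monoʳ-≤ (8 * D) h))

8/11*[11Λ/8P]≤Λ/P : ∀ Λ P D .{{_ : NonZero P}} .{{_ : NonZero D}} → D ≡ 8 * P →
  (+ 8 / 11) ℚ.* (+ (11 * Λ) / D) ≤ + Λ / P
8/11*[11Λ/8P]≤Λ/P Λ P D refl = subst₂ _≤_
  (trans (ℚ.+-identityʳ _) (sym (fraction-* 8 11 (11 * Λ) D))) (ℚ.+-identityʳ _)
  (fraction-+-≤ (8 * (11 * Λ)) (11 * D) 0 1 Λ P 0 1 (ℕ.≤-reflexive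
    (solve 2 (λ l P → (con 8 :* (con 11 :* l) :* con 1 :+ con 0 :* (con 11 :* (con 8 :* P))) :* (P :* con 1)
       := (l :* con 1 :+ con 0 :* P) :* (con 11 :* (con 8 :* P) :* con 1)) refl Λ P)))
  where
  instance
    11D≢0 : NonZero (11 * D)
    11D≢0 = ℕ.m*n≢0 11 D

exponent-bound : ∀ a w t c ℓ ε → a ≤ w + ε → w + t ≤ c + + 23 / 10 → (+ 8 / 11) ℚ.* c ≤ ℓ →
  (+ 8 / 11) ℚ.* (a - (+ 9 / 2) + t - ε) + + 8 / 5 ≤ ℓ
exponent-bound a w t c ℓ ε a≤ w≤ c≤ = begin
  (+ 8 / 11) ℚ.* (a - (+ 9 / 2) + t - ε) + + 8 / 5
    ≤⟨ ℚ.+-monoˡ-≤ (+ 8 / 5) (ℚ.*-monoˡ-≤-nonNeg (+ 8 / 11) inner) ⟩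
  (+ 8 / 11) ℚ.* (c + + 23 / 10 - + 9 / 2) + + 8 / 5
    -- The constants cancel: `8/11 * (23/10 - 9/2) = - 8/5`.
    ≡⟨ solveℚ 1 (λ c → conℚ (+ 8 / 11) ⊗ (c ⊕ conℚ (+ 23 / 10) :- conℚ (+ 9 / 2)) ⊕ conℚ (+ 8 / 5) ⊜ conℚ (+ 8 / 11) ⊗ c) refl c ⟩
  (+ 8 / 11) ℚ.* c
    ≤⟨ c≤ ⟩
  ℓ ∎
  where
  open ℚ.≤-Reasoning
  inner : a - (+ 9 / 2) + t - ε ≤ c + + 23 / 10 - + 9 / 2
  inner = begin
    a - (+ 9 / 2) + t - ε
      ≤⟨ ℚ.+-monoˡ-≤ (ℚ.- ε) (ℚ.+-monoˡ-≤ t (ℚ.+-monoˡ-≤ (ℚ.- (+ 9 / 2)) a≤)) ⟩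
    w + ε - (+ 9 / 2) + t - ε
      ≡⟨ solveℚ 4 (λ w e h t → w ⊕ e :- h ⊕ t :- e ⊜ w ⊕ t :- h) refl w ε (+ 9 / 2) t ⟩
    w + t - + 9 / 2
      ≤⟨ ℚ.+-monoˡ-≤ (ℚ.- (+ 9 / 2)) w≤ ⟩
    c + + 23 / 10 - + 9 / 2 ∎

-- The limit and its bound for fixed `k`.

module Average (κ p m : ℕ) (k+1≡ : 2 ℕ.+ κ ≡ 2 ^ p ℕ.+ m) (m< : m ℕ.< 2 ^ p) where

  k mean P D Λ : ℕ
  k    = suc κ
  -- Since `k < 2 ^ suc p`, the estimates for `σ` apply with `l = suc p`, that is with
  -- `2 + l = 3 + p` digits.
  mean = digitSum (3 ℕ.+ p) (size k)
  P    = 2 ^ p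
  D    = 2 ^ (3 ℕ.+ p)
  Λ    = logInterp p m

  instance
    P≢0 : NonZero P
    P≢0 = ℕ.m^n≢0 2 p
    D≢0 : NonZero D
    D≢0 = ℕ.m^n≢0 2 (3 ℕ.+ p)
    5P≢0 : NonZero (5 * P)
    5P≢0 = ℕ.m*n≢0 5 P

  D≡8P : D ≡ 8 * P
  D≡8P = ℕ.^-distribˡ-+-* 2 3 p

  k<2P : k ℕ.< 2 ^ suc p
  k<2P = begin
    suc k          ≡⟨ k+1≡ ⟩
    P ℕ.+ m        ≤⟨ ℕ.+-monoʳ-≤ P (ℕ.<⇒≤ m<) ⟩
    P ℕ.+ P        ≡⟨ cong (λ z → P ℕ.+ z) (sym (ℕ.+-identityʳ P)) ⟩
    2 ^ suc p      ∎
    where open ℕ.≤-Reasoning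

  σₖ : ℕ → ℕ
  σₖ j = σ k (k ℕ.+ j)

  limit : ℚ
  limit = + mean / D

  avg-upper : ∀ ε → 0ℚ < ε → ∃ λ M₀ → ∀ M → M ≥ M₀ → avg k M ≤ limit + ε
  avg-upper ε ε>0 = proj₁ bound , λ M M≥ →
    subst (λ s → + s / suc M ≤ limit + ε) (sym (σsum-partialSum k M)) (proj₂ bound M M≥)
    where bound = averages-upper (partialSum σₖ) mean D (average-upper σₖ D mean (σ-upper (suc p) κ k<2P)) ε ε>0

  avg-lower : ∀ ε → 0ℚ < ε → ∃ λ M₀ → ∀ M → M ≥ M₀ → limit ≤ avg k M + ε
  avg-lower ε ε>0 = proj₁ bound , λ M M≥ →
    subst (λ s → limit ≤ + s / suc M + ε) (sym (σsum-partialSum k M)) (proj₂ bound M M≥)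
    where bound = averages-lower (partialSum σₖ) mean D (average-lower σₖ D mean (σ-lower (suc p) κ k<2P)) ε ε>0

  avg≤⇒≤log₂ : ∀ a ε → a ≤ limit + ε →
    ((+ 8 / 11) ℚ.* (a - (+ 9 / 2) + (+ 9 / (4 * suc k)) - ε)) ≤log₂ (+ (suc k) / 3)
  avg≤⇒≤log₂ a ε a≤ = ≤log₂-fraction y (suc k) 3 (5 * Λ) (8 * P) (5 * P)
    (clear-denominators y Λ P (exponent-bound a limit t (+ (11 * Λ) / D) (+ Λ / P) ε a≤
      (mean-fraction-bound mean (suc k) P D Λ D≡8P (mean-bound p k m (s≤s z≤n) k+1≡ m<))
      (8/11*[11Λ/8P]≤Λ/P Λ P D D≡8P)))
    (subst (λ x → 2 ^ (5 * Λ) * 3 ^ (5 * P) ℕ.≤ 2 ^ (8 * P) * x ^ (5 * P)) (sym k+1≡) (3-logInterp p m (ℕ.<⇒≤ m<)))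
    where
    t = + 9 / (4 * suc k)
    y = (+ 8 / 11) ℚ.* (a - (+ 9 / 2) + t - ε)

theorem3 : (k : ℕ) → k ≥ 1 →
    ((ε : ℚ) → 0ℚ < ε → Σ ℕ λ M₀ → (M M′ : ℕ) → M ≥ M₀ → M′ ≥ M₀ →
    ∣ avg k M - avg k M′ ∣ ≤ ε)
    ×
    ((ε : ℚ) → 0ℚ < ε → Σ ℕ λ M₀ → (M : ℕ) → M ≥ M₀ →
    ((+ 8 / 11) ℚ.* (avg k M - (+ 9 / 2) + (+ 9 / (4 * suc k)) - ε))
    ≤log₂ (+ (suc k) / 3))
theorem3 (suc κ) _ =
  limits⇒cauchy (avg k) limit avg-upper avg-lower ,
  -- The `ε` subtracted in the exponent is also the tolerance of `avg-upper`, so the two cancel in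
  -- `exponent-bound`.
  λ ε ε>0 → proj₁ (avg-upper ε ε>0) , λ M M≥ → avg≤⇒≤log₂ (avg k M) ε (proj₂ (avg-upper ε ε>0) M M≥)
  where
  decomposition = binary-decomposition (2 ℕ.+ κ) (s≤s z≤n)
  open Average κ (proj₁ decomposition) (proj₁ (proj₂ decomposition))
    (proj₁ (proj₂ (proj₂ decomposition))) (proj₂ (proj₂ (proj₂ decomposition)))
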